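{- Assume $\mathrm{add}(\mathcal N)=\mathfrak c$. Then for every $\mathcal I\in\{\mathcal N,\mathcal M,\mathcal K\}$ and every $R\in\{\in^*,\leq^*,\neq^*\}$ we have $\mathfrak b(R_{\mathcal I})\ge\mathfrak c^+$ and $\mathfrak d(R_{\mathcal I})\ge\mathfrak c^+$.
   Context: $\mathfrak c=2^{\aleph_0}$. $\omega^\omega$ is Baire space with Lebesgue measure $\mu$: the (completed) Borel measure with $\mu(N_s)=\prod_{i<\mathrm{length}(s)}2^{ -(s(i)+1)}$ for $s\in\omega^{<\omega}$, where $N_s=\{x\in\omega^\omega: s\subseteq x\}$. $\mathcal N$ is the ideal of $\mu$-null subsets of $\omega^\omega$, $\mathcal M$ the ideal of meager subsets of $\omega^\omega$, and $\mathcal K$ the ideal of subsets of $\omega^\omega$ contained in a $\sigma$-compact set. $\mathrm{add}(\mathcal N)$ is the least size of a family of null sets whose union is not null. A slalom is a function $s:\omega\to[\omega]^{<\omega}$ with $|s(n)|\le n$ for all $n$; $\mathcal S$ is the set of slaloms. For $x,y\in\omega^\omega$ and $s\in\mathcal S$: $x\leq^* y$ iff $x(n)\le y(n)$ for all but finitely many $n$; $x\neq^* y$ iff $x(n)\ne y(n)$ for all but finitely many $n$; $x\in^* s$ iff $x(n)\in s(n)$ for all but finitely many $n$. For $\mathcal I\in\{\mathcal N,\mathcal M,\mathcal K\}$, $R\in\{\leq^*,\neq^*,\in^*\}$, $f:\omega^\omega\to\omega^\omega$ and $g:\omega^\omega\to\omega^\omega$ ($g:\omega^\omega\to\mathcal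 S$ if $R$ is $\in^*$), write $f R_{\mathcal I} g$ iff $\{x\in\omega^\omega:\neg\, f(x) R g(x)\}\in\mathcal I$. Then $\mathfrak b(R_{\mathcal I})$ is the least size of a set $A$ of functions $\omega^\omega\to\omega^\omega$ for which there is no $g:\omega^\omega\to\omega^\omega$ (no $g:\omega^\omega\to\mathcal S$ if $R$ is $\in^*$) with $f R_{\mathcal I} g$ for all $f\in A$; and $\mathfrak d(R_{\mathcal I})$ is the least size of a set $A$ of functions $\omega^\omega\to\omega^\omega$ (functions $\omega^\omega\to\mathcal S$ if $R$ is $\in^*$) such that for every $g:\omega^\omega\to\omega^\omega$ there is $f\in A$ with $g R_{\mathcal I} f$. -}

module Defs where

open import Level using (Level; 0ℓ; Lift) renaming (suc to lsuc; _⊔_ to _⊔ˡ_)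
open import Data.Bool using (Bool)
open import Data.Fin using (Fin; toℕ)
open import Data.List using (List; []; _∷_; length; lookup)
open import Data.List.Membership.Propositional using () renaming (_∈_ to _∈ᴸ_)
open import Data.List.Relation.Unary.Any using (Any)
open import Data.List.Relation.Unary.Linked using (Linked)
open import Data.Nat using (ℕ; zero; suc) renaming (_≤_ to _≤ℕ_; _<_ to _<ℕ_)
open import Data.Product using (Σ-syntax; ∃-syntax; _×_; proj₁)
open import Data.Rational using (ℚ; 0ℚ; 1ℚ; ½; _+_; _*_; _≤_; _<_)
open import Function.Bundles using (Bijection; Injection)
open import Relation.Binary.Bundles using (Setoid)
import Relation.Binary.Construct.On as On
open import Relation.Binary.PropositionalEquality using (_≡_; _≢_; setoid)
open import Relation.Nullary using (¬_)
open import Relation.Unary using (Pred; _∈_; _⊆_; _≬_; Empty; Satisfiable; ⋃)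
open import Relation.Unary.Relation.Binary.Equality using (≐-setoid)

private
  variable
    a a′ b b′ ℓ p : Level

-- A cardinal is represented by a setoid.

infix 4 _≼_ _≺_

_≼_ : Setoid a b → Setoid a′ b′ → Set (a ⊔ˡ b ⊔ˡ a′ ⊔ˡ b′)
κ ≼ ν = Injection κ ν

_≺_ : Setoid a b → Setoid a′ b′ → Set (a ⊔ˡ b ⊔ˡ a′ ⊔ˡ b′)
κ ≺ ν = κ ≼ ν × ¬ (ν ≼ κ)

-- The size of a set A of elements of S: elements are compared in S, so
-- neither the proofs of membership nor the choice of a representative
-- contribute to the size.
size : (S : Setoid a b) → Pred (Setoid.Carrier S) p → Setoid (a ⊔ˡ p) b
size S A = On.setoid S (proj₁ {B = A})

-- κ = min { |A| : P A }
IsLeastSize : (S : Setoid a b) → Setoid a′ b′ →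
              Pred (Pred (Setoid.Carrier S) 0ℓ) p →
              Set (lsuc 0ℓ ⊔ˡ a ⊔ˡ b ⊔ˡ a′ ⊔ˡ b′ ⊔ˡ p)
IsLeastSize S κ P =
  (∃[ A ] P A × Bijection κ (size S A)) × (∀ A → P A → κ ≼ size S A)

-- κ⁺ ≤ min { |A| : P A }.  As κ⁺ is the least cardinal above κ, κ⁺ ≤ |A|
-- is κ ≺ |A|.  The minimum is over a nonempty class.
SuccessorBelowLeastSize : (S : Setoid a b) → Setoid a′ b′ →
                          Pred (Pred (Setoid.Carrier S) 0ℓ) p →
                          Set (lsuc 0ℓ ⊔ˡ a ⊔ˡ b ⊔ˡ a′ ⊔ˡ b′ ⊔ˡ p)
SuccessorBelowLeastSize S κ P =
  Satisfiable P × (∀ A → P A → κ ≺ size S A)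

𝔠 : Setoid 0ℓ 0ℓ
𝔠 = setoid (ℕ → Bool)

ωω : Set
ωω = ℕ → ℕ

N : List ℕ → Pred ωω 0ℓ
N s x = ∀ (i : Fin (length s)) → lookup s i ≡ x (toℕ i)

Interior : Pred ωω 0ℓ → Pred ωω 0ℓ
Interior X x = ∃[ s ] x ∈ N s × N s ⊆ X

Closure : Pred ωω 0ℓ → Pred ωω 0ℓ
Closure X x = ∀ s → x ∈ N s → N s ≬ X

Open : Pred ωω 0ℓ → Set
Open X = X ⊆ Interior X

NowhereDense : Pred ωω 0ℓ → Set
NowhereDense X = Empty (Interior (Closure X))

Compact : Pred ωω 0ℓ → Set₁
Compact X = ∀ (I : Set) (U : I → Pred ωω 0ℓ) → (∀ i → Open (U i)) →
            X ⊆ ⋃ I U → Σ[ is ∈ List I ] X ⊆ (λ x → Any (λ i → x ∈ U i) is)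

½^_ : ℕ → ℚ
½^ zero    = 1ℚ
½^ (suc n) = ½ * (½^ n)

μN : List ℕ → ℚ
μN []      = 1ℚ
μN (k ∷ s) = (½^ (suc k)) * μN s

∑[_] : ℕ → (ℕ → ℚ) → ℚ
∑[ zero  ] f = 0ℚ
∑[ suc n ] f = ∑[ n ] f + f n

-- The measure is the completed Borel measure extending μN, so its null sets
-- are those of outer measure zero, the outer measure of X being the infimum
-- of the sums ∑ₖ μ(N_{sₖ}) over countable covers of X by basic open sets.
-- Such a sum is at most ε exactly when all of its partial sums are.
Null : Pred ωω ℓ → Set ℓ
Null X = ∀ (ε : ℚ) → 0ℚ < ε →
  Σ[ s ∈ (ℕ → List ℕ) ] X ⊆ ⋃ ℕ (λ k → N (s k)) × (∀ n → ∑[ n ] (λ k → μN (s k)) ≤ ε)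

Meager : Pred ωω 0ℓ → Set₁
Meager X =
  Σ[ F ∈ (ℕ → Pred ωω 0ℓ) ] (∀ n → NowhereDense (F n)) × X ⊆ ⋃ ℕ F

σ-Bounded : Pred ωω 0ℓ → Set₁
σ-Bounded X =
  Σ[ F ∈ (ℕ → Pred ωω 0ℓ) ] (∀ n → Compact (F n)) × X ⊆ ⋃ ℕ F

data Ideal : Set where
  𝒩 ℳ 𝒦 : Ideal

infix 4 _∈ᴵ_

_∈ᴵ_ : Pred ωω 0ℓ → Ideal → Set₁
X ∈ᴵ 𝒩 = Lift (lsuc 0ℓ) (Null X)
X ∈ᴵ ℳ = Meager X
X ∈ᴵ 𝒦 = σ-Bounded X

⋃₀ : Pred (Pred ωω 0ℓ) 0ℓ → Pred ωω (lsuc 0ℓ)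
⋃₀ 𝓕 x = ∃[ X ] X ∈ 𝓕 × x ∈ X

NullFamilyWithNonNullUnion : Pred (Pred (Pred ωω 0ℓ) 0ℓ) (lsuc 0ℓ)
NullFamilyWithNonNullUnion 𝓕 = (∀ X → X ∈ 𝓕 → Null X) × ¬ Null (⋃₀ 𝓕)

-- add(𝒩) = κ.  Sets of reals are compared extensionally.
add𝒩-is : Setoid a b → Set (lsuc 0ℓ ⊔ˡ a ⊔ˡ b)
add𝒩-is κ = IsLeastSize (≐-setoid ωω 0ℓ) κ NullFamilyWithNonNullUnion

-- A finite set of naturals is given by its strictly increasing enumeration,
-- so that propositional equality is equality of sets and the cardinality is
-- the length.
record FinSet : Set where
  constructor finSet
  field
    elements    : List ℕ
    .increasing : Linked _<ℕ_ elements

open FinSet public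

card : FinSet → ℕ
card F = length (elements F)

record Slalom : Set where
  constructor slalom
  field
    at     : ℕ → FinSet
    .bound : ∀ n → card (at n) ≤ℕ n

open Slalom public

∀∞ : Pred ℕ 0ℓ → Set
∀∞ P = ∃[ m ] ∀ n → m ≤ℕ n → P n

data Rel : Set where
  ∈* ≤* ≠* : Rel

Target : Rel → Set
Target ∈* = Slalom
Target ≤* = ωω
Target ≠* = ωω

_⟦_⟧_ : ωω → (R : Rel) → Target R → Set
x ⟦ ∈* ⟧ s = ∀∞ (λ n → x n ∈ᴸ elements (at s n))
x ⟦ ≤* ⟧ y = ∀∞ (λ n → x n ≤ℕ y n)
x ⟦ ≠* ⟧ y = ∀∞ (λ n → x n ≢ y n)

_⟦_,_⟧_ : (ωω → ωω) → (R : Rel) → Ideal → (ωω → Target R) → Set₁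
f ⟦ R , I ⟧ g = (λ x → ¬ (f x ⟦ R ⟧ g x)) ∈ᴵ I

Unbounded : (R : Rel) → Ideal → Pred (Pred (ωω → ωω) 0ℓ) (lsuc 0ℓ)
Unbounded R I A = ¬ (Σ[ g ∈ (ωω → Target R) ] ∀ f → f ∈ A → f ⟦ R , I ⟧ g)

Dominating : (R : Rel) → Ideal → Pred (Pred (ωω → Target R) 0ℓ) (lsuc 0ℓ)
Dominating R I A = ∀ g → Σ[ f ∈ (ωω → Target R) ] f ∈ A × g ⟦ R , I ⟧ f

_⁺≤𝔟⟦_,_⟧ : Setoid a b → Rel → Ideal → Set (lsuc 0ℓ ⊔ˡ a ⊔ˡ b)
κ ⁺≤𝔟⟦ R , I ⟧ = SuccessorBelowLeastSize (setoid (ωω → ωω)) κ (Unbounded R I)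

_⁺≤𝔡⟦_,_⟧ : Setoid a b → Rel → Ideal → Set (lsuc 0ℓ ⊔ˡ a ⊔ˡ b)
κ ⁺≤𝔡⟦ R , I ⟧ =
  SuccessorBelowLeastSize (setoid (ωω → Target R)) κ (Dominating R I)

{-# OPTIONS --safe #-}
module Submission where

-- Call an index set small if 2^ω does not inject into it.  Everything rests on Bartoszyński's theorem
-- that, under add(𝒩) = 𝔠, every small family of reals is localised by a single slalom.  To f one
-- attaches the null set of those x in which infinitely many of the independent events O(n, f(n)), of
-- measure 2^{-(n+1)}, occur.  The union of a small family of these null sets is covered by basic open
-- sets of total measure at most 1/2.  In the tree T of nodes in which a positive proportion is left
-- uncovered, a branch meeting O(n, f(n)) infinitely often would avoid the cover; so below some node of
-- T almost all events O(n, f(n)) are missed, and by independence few values are missed for each n.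
--
-- Hence small sets of reals lie in 𝒩, 𝒦 and ℳ.  Well-order 2^ω with small initial segments.  For 𝔟,
-- given f_c (c ∈ 2^ω), let g(x) bound all f_c(x) with c below the index of x: then f_c R g fails on a
-- small set only.  For 𝔡, a Bernstein-style recursion along a base of size 𝔠 splits ω^ω into sets
-- Z_c (c ∈ 2^ω) outside the ideal, and g is chosen so that g(x) R f_c(x) fails for all x ∈ Z_c.

open import Defs
open import Algebra.Bundles using (CommutativeMonoid)
open import Axiom.ExcludedMiddle using (ExcludedMiddle)
open import Axiom.Extensionality.Propositional using (Extensionality)
open import Data.Bool using (Bool; true; false; if_then_else_)
open import Data.Empty using (⊥; ⊥-elim)
open import Data.Fin using (Fin; zero; suc; toℕ)
open import Data.Fin.Properties using (toℕ<n)
open import Data.Integer as ℤ using ()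
open import Data.List using (List; []; _∷_; [_]; _++_; length; replicate; map; foldr; lookup; head; drop; applyUpTo)
open import Data.List.Membership.Propositional using () renaming (_∈_ to _∈ᴸ_)
open import Data.List.Membership.Propositional.Properties using (∈-++⁺ˡ; ∈-++⁺ʳ; ∈-map⁺; ∈-applyUpTo⁺)
open import Data.List.Properties using
  ( length-++; length-replicate; length-map; length-applyUpTo; lookup-applyUpTo
  ; ++-assoc; ++-identityʳ; ∷-injectiveˡ; ∷-injectiveʳ)
open import Data.List.Relation.Unary.All as All using (All; []; _∷_)
import Data.List.Relation.Unary.All.Properties as All
open import Data.List.Relation.Unary.Any as Any using (Any; here; there)
open import Data.List.Relation.Unary.Any.Properties using (++⁺ˡ; ++⁺ʳ; lookup-index)
open import Data.List.Relation.Unary.Linked using (Linked; []; [-]; _∷_)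
open import Data.Maybe using (Maybe; just; nothing; fromMaybe)
open import Data.Maybe.Properties using (just-injective)
open import Data.Nat as ℕ using (ℕ; zero; suc; _+_; _*_; _^_; _∸_; _≤_; _<_; z≤n; s≤s)
open import Data.Nat.Binary using (ℕᵇ; 2[1+_]; 1+[2_]) renaming (zero to 0ᵇ; toℕ to ℕᵇ→ℕ)
open import Data.Nat.Binary.Properties using (2[1+_]-injective; 1+[2_]-injective)
  renaming (toℕ-injective to ℕᵇ→ℕ-injective)
import Data.Nat.Coprimality as Coprimality
open import Data.Nat.Induction using (<-wellFounded)
open import Data.Nat.ListAction using (sum)
import Data.Nat.Properties as ℕ
open import Data.Product using (∃-syntax; Σ-syntax; _×_; _,_; proj₁; proj₂)
open import Data.Rational as ℚ using (ℚ; 0ℚ; 1ℚ; ½; mkℚ; *≤*; *<*)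
import Data.Rational.Properties as ℚ
import Data.Rational.Unnormalised as ℚᵘ
import Data.Rational.Unnormalised.Properties as ℚᵘ
open import Data.Sum using (_⊎_; inj₁; inj₂)
open import Data.Unit using (⊤; tt)
open import Function using (_∘_)
open import Function.Bundles using (Injection; mk↣)
open import Induction.WellFounded using (WellFounded; Acc; acc)
open import Level using (Level; 0ℓ; lift)
open import Relation.Binary.Core using () renaming (Rel to Rel₂)
import Relation.Binary.Construct.On as On
open import Relation.Binary.Definitions using (Tri; tri<; tri≈; tri>)
open import Relation.Binary.PropositionalEquality
  using (_≡_; _≢_; refl; sym; trans; cong; cong₂; subst; subst₂; setoid; module ≡-Reasoning)
open import Relation.Nullary using (¬_; Dec; yes; no; does; contradiction)
open import Relation.Unary using (Pred; _∈_; _⊆_; _≐_; ⋃; U)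
open import Algebra.Properties.CommutativeSemigroup
  (CommutativeMonoid.commutativeSemigroup ℚ.+-0-commutativeMonoid)
  using (interchange)

private
  variable
    p ℓ : Level
    X : Set

-- Dyadic rationals and finite sums

½^-pos : ∀ n → 0ℚ ℚ.< ½^ n
½^-pos zero    = *<* (ℤ.+<+ (s≤s z≤n))
½^-pos (suc n) = subst (ℚ._< ½^ suc n) (ℚ.*-zeroʳ ½) (ℚ.*-monoʳ-<-pos ½ (½^-pos n))

½^-nonNeg : ∀ n → 0ℚ ℚ.≤ ½^ n
½^-nonNeg n = ℚ.<⇒≤ (½^-pos n)

½*p+½*p≡p : ∀ p → ½ ℚ.* p ℚ.+ ½ ℚ.* p ≡ p
½*p+½*p≡p p = trans (sym (ℚ.*-distribʳ-+ p ½ ½)) (ℚ.*-identityˡ p)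

½^-halves : ∀ n → ½^ suc n ℚ.+ ½^ suc n ≡ ½^ n
½^-halves n = ½*p+½*p≡p (½^ n)

p≤p+q : ∀ p {q} → 0ℚ ℚ.≤ q → p ℚ.≤ p ℚ.+ q
p≤p+q p {q} 0≤q = subst (ℚ._≤ p ℚ.+ q) (ℚ.+-identityʳ p) (ℚ.+-monoʳ-≤ p 0≤q)

½^-anti : ∀ n j → ½^ (j + n) ℚ.≤ ½^ n
½^-anti n zero    = ℚ.≤-refl
½^-anti n (suc j) = ℚ.≤-trans
  (subst (½^ suc (j + n) ℚ.≤_) (½^-halves (j + n)) (p≤p+q _ (½^-nonNeg (suc (j + n)))))
  (½^-anti n j)

½^-+ : ∀ m n → ½^ (m + n) ≡ ½^ m ℚ.* ½^ n
½^-+ zero    n = sym (ℚ.*-identityˡ (½^ n))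
½^-+ (suc m) n = trans (cong (½ ℚ.*_) (½^-+ m n)) (sym (ℚ.*-assoc ½ (½^ m) (½^ n)))

-- The value is 1/(n + 1), since `mkℚ` stores the denominator minus one.
recip : ℕ → ℚ
recip n = mkℚ (ℤ.+ 1) n (Coprimality.1-coprimeTo (suc n))

½^≤recip : ∀ n → ½^ n ℚ.≤ recip n
½^≤recip zero    = ℚ.≤-refl
½^≤recip (suc n) = ℚ.≤-trans (ℚ.*-monoˡ-≤-nonNeg ½ (½^≤recip n)) (ℚ.toℚᵘ-cancel-≤
  (ℚᵘ.≤-trans (ℚᵘ.≤-reflexive (ℚ.toℚᵘ-homo-* ½ (recip n)))
    (ℚᵘ.*≤* (ℤ.+≤+ (ℕ.+-monoˡ-≤ 0 (s≤s (ℕ.≤-trans (s≤s (ℕ.m≤m+n n 0)) (ℕ.m≤n+m _ n))))))))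

½^-archimedean : ∀ ε → 0ℚ ℚ.< ε → ∃[ n ] ½^ n ℚ.≤ ε
½^-archimedean (mkℚ (ℤ.+ zero)  d c) (*<* (ℤ.+<+ ()))
-- A positive rational with denominator d + 1 is at least 1/(d + 1), hence at least `½^ d`.
½^-archimedean (mkℚ (ℤ.+ suc p) d c) _ =
  d , ℚ.≤-trans (½^≤recip d) (*≤* (ℤ.+≤+ (ℕ.*-monoˡ-≤ (suc d) (s≤s (z≤n {p})))))
½^-archimedean (mkℚ (ℤ.-[1+ p ]) d c) (*<* ())

∑-mono : ∀ {f} → (∀ k → 0ℚ ℚ.≤ f k) → ∀ m j → ∑[ m ] f ℚ.≤ ∑[ j + m ] f
∑-mono f≥0 m zero    = ℚ.≤-refl
∑-mono f≥0 m (suc j) = ℚ.≤-trans (∑-mono f≥0 m j) (p≤p+q _ (f≥0 (j + m)))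

∑-nonNeg : ∀ {f} → (∀ k → 0ℚ ℚ.≤ f k) → ∀ m → 0ℚ ℚ.≤ ∑[ m ] f
∑-nonNeg f≥0 m = subst (λ n → 0ℚ ℚ.≤ ∑[ n ] _) (ℕ.+-identityʳ m) (∑-mono f≥0 0 m)

∑-+ : ∀ f g n → ∑[ n ] (λ k → f k ℚ.+ g k) ≡ ∑[ n ] f ℚ.+ ∑[ n ] g
∑-+ f g zero    = refl
∑-+ f g (suc n) = trans (cong (ℚ._+ (f n ℚ.+ g n)) (∑-+ f g n)) (interchange (∑[ n ] f) (∑[ n ] g) (f n) (g n))

∑-cong : ∀ {f g} → (∀ k → f k ≡ g k) → ∀ n → ∑[ n ] f ≡ ∑[ n ] g
∑-cong f≡g zero    = refl
∑-cong f≡g (suc n) = cong₂ ℚ._+_ (∑-cong f≡g n) (f≡g n)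

-- Coin tossing

-- The conditional probability of the cylinder [u] given [σ].
share : List Bool → List Bool → ℚ
share []          σ           = 1ℚ
share (b ∷ u)     []          = ½ ℚ.* share u []
share (false ∷ u) (false ∷ σ) = share u σ
share (true ∷ u)  (true ∷ σ)  = share u σ
share (false ∷ u) (true ∷ σ)  = 0ℚ
share (true ∷ u)  (false ∷ σ) = 0ℚ

-- Law of total probability: the share in [σ] is the mean of the shares in its two halves, doubled
-- to avoid a division.
share-split : ∀ u σ → share u σ ℚ.+ share u σ ≡ share u (σ ++ [ false ]) ℚ.+ share u (σ ++ [ true ])
share-split []          σ           = refl
share-split (false ∷ u) []          = trans (½*p+½*p≡p (share u [])) (sym (ℚ.+-identityʳ _))
share-split (true ∷ u)  []          = trans (½*p+½*p≡p (share u [])) (sym (ℚ.+-identityˡ _))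
share-split (false ∷ u) (false ∷ σ) = share-split u σ
share-split (true ∷ u)  (true ∷ σ)  = share-split u σ
share-split (false ∷ u) (true ∷ σ)  = refl
share-split (true ∷ u)  (false ∷ σ) = refl

share-[] : ∀ u → share u [] ≡ ½^ length u
share-[] []      = refl
share-[] (b ∷ u) = cong (½ ℚ.*_) (share-[] u)

share-nonNeg : ∀ u σ → 0ℚ ℚ.≤ share u σ
share-nonNeg []          σ           = ½^-nonNeg 0
share-nonNeg u@(_ ∷ _)   []          = subst (0ℚ ℚ.≤_) (sym (share-[] u)) (½^-nonNeg (length u))
share-nonNeg (false ∷ u) (false ∷ σ) = share-nonNeg u σ
share-nonNeg (true ∷ u)  (true ∷ σ)  = share-nonNeg u σ
share-nonNeg (false ∷ u) (true ∷ σ)  = ℚ.≤-refl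
share-nonNeg (true ∷ u)  (false ∷ σ) = ℚ.≤-refl

share-prefix : ∀ u v → share u (u ++ v) ≡ 1ℚ
share-prefix []          v = refl
share-prefix (false ∷ u) v = share-prefix u v
share-prefix (true ∷ u)  v = share-prefix u v

-- x ∈ ω^ω is identified with the sequence 0^x(0) 1 0^x(1) 1 …, which turns
-- μ into the coin-tossing measure: μN s = 2^{-|code s|}.
code : List ℕ → List Bool
code []      = []
code (k ∷ s) = replicate k false ++ true ∷ code s

code-++ : ∀ s t → code (s ++ t) ≡ code s ++ code t
code-++ []      t = refl
code-++ (k ∷ s) t = trans (cong (λ z → replicate k false ++ true ∷ z) (code-++ s t))
                          (sym (++-assoc (replicate k false) (true ∷ code s) (code t)))

μN≡½^code : ∀ s → μN s ≡ ½^ length (code s)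
μN≡½^code []      = refl
μN≡½^code (k ∷ s) = begin
  ½^ suc k ℚ.* μN s                 ≡⟨ cong (½^ suc k ℚ.*_) (μN≡½^code s) ⟩
  ½^ suc k ℚ.* ½^ length (code s)   ≡⟨ ½^-+ (suc k) (length (code s)) ⟨
  ½^ (suc k + length (code s))      ≡⟨ cong ½^_ (ℕ.+-suc k _) ⟨
  ½^ (k + length (true ∷ code s))   ≡⟨ cong (λ j → ½^ (j + length (true ∷ code s))) (length-replicate k) ⟨
  ½^ (length (replicate k false) + length (true ∷ code s)) ≡⟨ cong ½^_ (length-++ (replicate k false)) ⟨
  ½^ length (code (k ∷ s))          ∎
  where open ≡-Reasoning

μN-nonNeg : ∀ s → 0ℚ ℚ.≤ μN s
μN-nonNeg s = subst (0ℚ ℚ.≤_) (sym (μN≡½^code s)) (½^-nonNeg (length (code s)))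

-- A word closed by a 1 can be read from the left: `true` completes an entry 0, and `false` raises
-- the first entry by one.
decode : ∀ w → ∃[ s ] code s ≡ w ++ [ true ]
decode []         = 0 ∷ [] , refl
decode (true ∷ w) with decode w
... | s , eq = 0 ∷ s , cong (true ∷_) eq
decode (false ∷ w) with decode w
... | k ∷ s , eq = suc k ∷ s , cong (false ∷_) eq
... | []    , eq with w
...   | []    = 1 ∷ [] , refl
...   | _ ∷ _ with () ← eq

module Classical (em : ∀ {ℓ} → ExcludedMiddle ℓ) (ext : ∀ {a b} → Extensionality a b) where

  -- Classical logic

  dne : {P : Set p} → ¬ ¬ P → P
  dne {P = P} ¬¬p with em {P = P}
  ... | yes q = q
  ... | no ¬p = contradiction ¬p ¬¬p

  counterexample : {P : X → Set p} → ¬ (∀ x → P x) → ∃[ x ] ¬ P x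
  counterexample ¬∀ = dne λ ¬∃ → ¬∀ λ x → dne λ ¬px → ¬∃ (x , ¬px)

  minimal : {_◂_ : Rel₂ X ℓ} → WellFounded _◂_ → (P : Pred X p) → ∀ {x} → P x →
            ∃[ y ] P y × ∀ z → z ◂ y → ¬ P z
  minimal {X = X} {_◂_ = _◂_} wf P {x} = go (wf x)
    where
    go : ∀ {x} → Acc _◂_ x → P x → ∃[ y ] P y × ∀ z → z ◂ y → ¬ P z
    go {x} (acc rs) px with em {P = ∃[ z ] z ◂ x × P z}
    ... | yes (z , z<x , pz) = go (rs z<x) pz
    ... | no ∄z = x , px , λ z z<x pz → ∄z (z , z<x , pz)

  -- The list may contain repetitions and entries outside P, so a union needs only concatenation.
  AtMost : ℕ → Pred ℕ p → Set p
  AtMost b P = ∃[ L ] length L ≤ b × ∀ k → P k → k ∈ᴸ L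

  AtMost-⊆ : ∀ {b} {P Q : Pred ℕ 0ℓ} → (∀ k → P k → Q k) → AtMost b Q → AtMost b P
  AtMost-⊆ P⊆Q (L , L≤b , Q⊆L) = L , L≤b , λ k → Q⊆L k ∘ P⊆Q k

  AtMost-∪ : ∀ {I : Set} {b} {P : I → Pred ℕ 0ℓ} → (∀ i → AtMost b (P i)) → ∀ is →
             AtMost (length is * b) (λ k → ∃[ i ] i ∈ᴸ is × P i k)
  AtMost-∪ am []       = [] , z≤n , λ { k (i , () , _) }
  AtMost-∪ {b = b} {P} am (i ∷ is) with am i | AtMost-∪ am is
  ... | L , L≤b , P⊆L | M , M≤ , Q⊆M =
    L ++ M , subst (_≤ b + length is * b) (sym (length-++ L)) (ℕ.+-mono-≤ L≤b M≤) , ⊆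
    where
    ⊆ : ∀ k → ∃[ j ] j ∈ᴸ i ∷ is × P j k → k ∈ᴸ L ++ M
    ⊆ k (j , here refl , pk) = ∈-++⁺ˡ (P⊆L k pk)
    ⊆ k (j , there j∈ , pk)  = ∈-++⁺ʳ L (Q⊆M k (j , j∈ , pk))

  -- Induction on b: once the least element of P is removed, chains of the remaining elements are
  -- shorter by one.
  boundedChains⇒AtMost : ∀ {P : Pred ℕ 0ℓ} b →
    (∀ ks → Linked _<_ ks → All P ks → length ks ≤ b) → AtMost b P
  boundedChains⇒AtMost {P = P} zero h = [] , z≤n , λ k pk → contradiction (h (k ∷ []) [-] (pk ∷ [])) λ ()
  boundedChains⇒AtMost {P = P} (suc b) h with em {P = ∃[ k ] P k}
  ... | no ∄k = [] , z≤n , λ k pk → contradiction (k , pk) ∄k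
  ... | yes (_ , pk) with minimal <-wellFounded P pk
  ... | k , pk , min = extend (boundedChains⇒AtMost {P = λ j → k < j × P j} b chains)
    where
    chains : ∀ ks → Linked _<_ ks → All (λ j → k < j × P j) ks → length ks ≤ b
    chains []       _ _ = z≤n
    chains (j ∷ ks) l ps@((k<j , _) ∷ _) = ℕ.s≤s⁻¹ (h (k ∷ j ∷ ks) (k<j ∷ l) (pk ∷ All.map proj₂ ps))
    extend : AtMost b (λ j → k < j × P j) → AtMost (suc b) P
    extend (L , L≤b , ⊆L) = k ∷ L , s≤s L≤b , λ j pj → case j pj (ℕ.<-cmp j k)
      where
      case : ∀ j → P j → Tri (j < k) (j ≡ k) (k < j) → j ∈ᴸ k ∷ L
      case j pj (tri< j<k _ _) = contradiction pj (min j j<k)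
      case j pj (tri≈ _ refl _) = here refl
      case j pj (tri> _ _ k<j) = there (⊆L j (k<j , pj))

  -- Nodes of the tree left uncovered

  infix 8 _·½^_

  -- The fraction k/2^m, kept with its numerator so that gains of measure can be counted in ℕ.
  _·½^_ : ℕ → ℕ → ℚ
  zero  ·½^ m = 0ℚ
  suc k ·½^ m = ½^ m ℚ.+ k ·½^ m

  ·½^-homo-+ : ∀ j k m → (j + k) ·½^ m ≡ j ·½^ m ℚ.+ k ·½^ m
  ·½^-homo-+ zero    k m = sym (ℚ.+-identityˡ _)
  ·½^-homo-+ (suc j) k m = trans (cong (½^ m ℚ.+_) (·½^-homo-+ j k m)) (sym (ℚ.+-assoc (½^ m) (j ·½^ m) (k ·½^ m)))

  ·½^-nonNeg : ∀ k m → 0ℚ ℚ.≤ k ·½^ m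
  ·½^-nonNeg zero    m = ℚ.≤-refl
  ·½^-nonNeg (suc k) m = ℚ.≤-trans (½^-nonNeg m) (p≤p+q _ (·½^-nonNeg k m))

  ·½^-mono : ∀ {j k} m → j ≤ k → j ·½^ m ℚ.≤ k ·½^ m
  ·½^-mono {k = k} m z≤n = ·½^-nonNeg k m
  ·½^-mono m (s≤s j≤k)   = ℚ.+-monoʳ-≤ (½^ m) (·½^-mono m j≤k)

  ·½^-refine : ∀ k m → (k + k) ·½^ suc m ≡ k ·½^ m
  ·½^-refine zero    m = refl
  ·½^-refine (suc k) m = begin
    ½^ suc m ℚ.+ (k + suc k) ·½^ suc m               ≡⟨ cong (λ j → ½^ suc m ℚ.+ j ·½^ suc m) (ℕ.+-suc k k) ⟩
    ½^ suc m ℚ.+ (½^ suc m ℚ.+ (k + k) ·½^ suc m)    ≡⟨ ℚ.+-assoc (½^ suc m) (½^ suc m) ((k + k) ·½^ suc m) ⟨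
    (½^ suc m ℚ.+ ½^ suc m) ℚ.+ (k + k) ·½^ suc m    ≡⟨ cong₂ ℚ._+_ (½^-halves m) (·½^-refine k m) ⟩
    ½^ m ℚ.+ k ·½^ m                                 ∎
    where open ≡-Reasoning

  2^m·½^[m+n]≡½^n : ∀ m n → (2 ^ m) ·½^ (m + n) ≡ ½^ n
  2^m·½^[m+n]≡½^n zero    n = ℚ.+-identityʳ (½^ n)
  2^m·½^[m+n]≡½^n (suc m) n = begin
    (2 ^ m + (2 ^ m + 0)) ·½^ suc (m + n) ≡⟨ cong (λ j → (2 ^ m + j) ·½^ suc (m + n)) (ℕ.+-identityʳ (2 ^ m)) ⟩
    (2 ^ m + 2 ^ m) ·½^ suc (m + n)       ≡⟨ ·½^-refine (2 ^ m) (m + n) ⟩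
    (2 ^ m) ·½^ (m + n)                   ≡⟨ 2^m·½^[m+n]≡½^n m n ⟩
    ½^ n                                  ∎
    where open ≡-Reasoning

  2^m·½^m≡1 : ∀ m → (2 ^ m) ·½^ m ≡ 1ℚ
  2^m·½^m≡1 m = subst (λ n → (2 ^ m) ·½^ n ≡ 1ℚ) (ℕ.+-identityʳ m) (2^m·½^[m+n]≡½^n m 0)

  module Thickness (u : ℕ → List Bool) where

    -- The relative measure in [σ] of the first N sets of the cover, counted with multiplicity; it
    -- may exceed 1.
    covered : ℕ → List Bool → ℚ
    covered N σ = ∑[ N ] (λ k → share (u k) σ)

    covered-split : ∀ N σ → covered N σ ℚ.+ covered N σ ≡
                    covered N (σ ++ [ false ]) ℚ.+ covered N (σ ++ [ true ])
    covered-split N σ = trans (sym (∑-+ _ _ N)) (trans (∑-cong (λ k → share-split (u k) σ) N) (∑-+ _ _ N))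

    covered-nonNeg : ∀ N σ → 0ℚ ℚ.≤ covered N σ
    covered-nonNeg N σ = ∑-nonNeg (λ k → share-nonNeg (u k) σ) N

    covered-mono : ∀ N j σ → covered N σ ℚ.≤ covered (j + N) σ
    covered-mono N j σ = ∑-mono (λ k → share-nonNeg (u k) σ) N j

    -- At least the fraction k/2^m of [σ] is left uncovered.
    record Gap (m : ℕ) (σ : List Bool) (k : ℕ) : Set where
      constructor gap
      field below : ∀ N → covered N σ ℚ.+ k ·½^ m ℚ.≤ 1ℚ

    open Gap

    Thick : List Bool → Set
    Thick σ = ∃[ m ] Gap m σ 1

    Gap-mono : ∀ {m σ j k} → j ≤ k → Gap m σ k → Gap m σ j
    Gap-mono {m} {σ} j≤k g .below N = ℚ.≤-trans (ℚ.+-monoʳ-≤ (covered N σ) (·½^-mono m j≤k)) (g .below N)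

    Gap-refine : ∀ {m σ k} j → Gap m σ k → Gap (j + m) σ (2 ^ j * k)
    Gap-refine {k = k} zero g = subst (Gap _ _) (sym (ℕ.+-identityʳ k)) g
    Gap-refine {m} {σ} {k} (suc j) g .below N = subst (λ q → covered N σ ℚ.+ q ℚ.≤ 1ℚ) eq (Gap-refine j g .below N)
      where
      open ≡-Reasoning
      eq : (2 ^ j * k) ·½^ (j + m) ≡ (2 ^ suc j * k) ·½^ (suc j + m)
      eq = begin
        (2 ^ j * k) ·½^ (j + m)                   ≡⟨ ·½^-refine (2 ^ j * k) (j + m) ⟨
        (2 ^ j * k + 2 ^ j * k) ·½^ (suc j + m)   ≡⟨ cong (λ i → (2 ^ j * k + i) ·½^ (suc j + m)) (ℕ.+-identityʳ _) ⟨
        (2 * (2 ^ j * k)) ·½^ (suc j + m)         ≡⟨ cong (_·½^ (suc j + m)) (ℕ.*-assoc 2 (2 ^ j) k) ⟨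
        (2 ^ suc j * k) ·½^ (suc j + m)           ∎

    Gap-weaken : ∀ {m n σ} → m ≤ n → Gap m σ 1 → Gap n σ 1
    Gap-weaken {m} {n} {σ} m≤n g = subst (λ i → Gap i σ 1) (ℕ.m∸n+n≡m m≤n)
      (Gap-mono (subst (1 ≤_) (sym (ℕ.*-identityʳ _)) (ℕ.m^n>0 2 (n ∸ m))) (Gap-refine (n ∸ m) g))

    -- At N = 0 nothing is covered yet, and the condition reads k/2^m ≤ 1.
    Gap-bound : ∀ {m σ k} → Gap m σ k → k ≤ 2 ^ m
    Gap-bound {m} {σ} {k} g = ℕ.≮⇒≥ λ 2^m<k → ℚ.<-irrefl refl (begin-strict
      1ℚ                          ≡⟨ ℚ.+-identityˡ 1ℚ ⟨
      0ℚ ℚ.+ 1ℚ                   <⟨ ℚ.+-monoˡ-< 1ℚ (½^-pos m) ⟩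
      ½^ m ℚ.+ 1ℚ                 ≡⟨ cong (½^ m ℚ.+_) (2^m·½^m≡1 m) ⟨
      suc (2 ^ m) ·½^ m           ≤⟨ ·½^-mono m 2^m<k ⟩
      k ·½^ m                     ≡⟨ ℚ.+-identityˡ _ ⟨
      covered 0 σ ℚ.+ k ·½^ m     ≤⟨ g .below 0 ⟩
      1ℚ                          ∎)
      where open ℚ.≤-Reasoning

    -- The gap of [σ] may be shared out unevenly between its halves. If both halves failed, at
    -- stages N₀ and N₁, both would fail at the common stage N₀ + N₁, as covered shares only grow;
    -- adding them up contradicts the gap of [σ].
    split : ∀ {m σ i j k} → i + j ≡ k + k → Gap m σ k → Gap m (σ ++ [ false ]) i ⊎ Gap m (σ ++ [ true ]) j
    split {m} {σ} {i} {j} {k} i+j≡k+k g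
      with em {P = Gap m (σ ++ [ false ]) i} | em {P = Gap m (σ ++ [ true ]) j}
    ... | yes g₀ | _      = inj₁ g₀
    ... | no _   | yes g₁ = inj₂ g₁
    ... | no ¬g₀ | no ¬g₁ with counterexample (¬g₀ ∘ gap) | counterexample (¬g₁ ∘ gap)
    ... | N₀ , h₀ | N₁ , h₁ = ⊥-elim (ℚ.<-irrefl refl (begin-strict
      1ℚ ℚ.+ 1ℚ                          <⟨ ℚ.+-mono-< (ℚ.<-≤-trans (ℚ.≰⇒> h₀) (ℚ.+-monoˡ-≤ _ mono₀))
                                                       (ℚ.<-≤-trans (ℚ.≰⇒> h₁) (ℚ.+-monoˡ-≤ _ (covered-mono N₁ N₀ _))) ⟩
      (c₀ ℚ.+ i ·½^ m) ℚ.+ (c₁ ℚ.+ j ·½^ m)   ≡⟨ interchange c₀ (i ·½^ m) c₁ (j ·½^ m) ⟩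
      (c₀ ℚ.+ c₁) ℚ.+ (i ·½^ m ℚ.+ j ·½^ m)   ≡⟨ cong₂ ℚ._+_ (sym (covered-split M σ)) i+j ⟩
      (c ℚ.+ c) ℚ.+ (k ·½^ m ℚ.+ k ·½^ m)     ≡⟨ interchange c c (k ·½^ m) (k ·½^ m) ⟩
      (c ℚ.+ k ·½^ m) ℚ.+ (c ℚ.+ k ·½^ m)     ≤⟨ ℚ.+-mono-≤ (g .below M) (g .below M) ⟩
      1ℚ ℚ.+ 1ℚ                          ∎))
      where
      open ℚ.≤-Reasoning
      M = N₀ + N₁
      c₀ = covered M (σ ++ [ false ])
      c₁ = covered M (σ ++ [ true ])
      c = covered M σ
      mono₀ : covered N₀ (σ ++ [ false ]) ℚ.≤ c₀
      mono₀ = subst (λ n → covered N₀ (σ ++ [ false ]) ℚ.≤ covered n (σ ++ [ false ])) (ℕ.+-comm N₁ N₀)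
                (covered-mono N₀ N₁ (σ ++ [ false ]))
      i+j : i ·½^ m ℚ.+ j ·½^ m ≡ k ·½^ m ℚ.+ k ·½^ m
      i+j = trans (sym (·½^-homo-+ i j m)) (trans (cong (_·½^ m) i+j≡k+k) (·½^-homo-+ k k m))

    Gap-extend : ∀ {m σ k} l → Gap m σ k → ∃[ v ] length v ≡ l × Gap m (σ ++ v) k
    Gap-extend zero g = [] , refl , subst (λ τ → Gap _ τ _) (sym (++-identityʳ _)) g
    Gap-extend {σ = σ} (suc l) g with split {σ = σ} refl g
    ... | inj₁ g₀ = let v , eq , h = Gap-extend l g₀ in
      false ∷ v , cong suc eq , subst (λ τ → Gap _ τ _) (++-assoc σ _ v) h
    ... | inj₂ g₁ = let v , eq , h = Gap-extend l g₁ in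
      true ∷ v , cong suc eq , subst (λ τ → Gap _ τ _) (++-assoc σ _ v) h

    -- The cover has full mass below σ1ⁿ, so less than its share below some node off this path: going
    -- down one level along the path costs e and doubles the gain.
    thinBlock : ∀ n {m σ d e} → 2 ^ n * e < d + e → Gap m σ d → ¬ Thick (σ ++ replicate n true) →
                ∃[ v ] length v ≤ n × Gap m (σ ++ v) (d + e)
    -- For n = 0 the hypothesis says 0 < d, which makes σ itself thick.
    thinBlock zero {m} {σ} {d} {e} e<d+e g thin = contradiction
      (m , Gap-mono (ℕ.+-cancelʳ-< e 0 d (subst (_< d + e) (ℕ.+-identityʳ e) e<d+e)) g)
      (subst (¬_ ∘ Thick) (++-identityʳ σ) thin)
    thinBlock (suc n) {m} {σ} {d} {e} h g thin = case (split {σ = σ} sums g)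
      where
      -- So the truncated `d ∸ e` is a true difference.
      e≤d : e ≤ d
      e≤d = ℕ.<⇒≤ (ℕ.+-cancelʳ-< e e d (ℕ.≤-<-trans (begin
        e + e           ≡⟨ cong (e +_) (ℕ.+-identityʳ e) ⟨
        2 * e           ≤⟨ ℕ.*-monoˡ-≤ e (ℕ.*-monoʳ-≤ 2 (ℕ.m^n>0 2 n)) ⟩
        2 ^ suc n * e   ∎) h))
        where open ℕ.≤-Reasoning
      -- The target d + e stays the same one level down, where d ∸ e replaces d and 2e replaces e.
      d∸e+2e : (d ∸ e) + (e + e) ≡ d + e
      d∸e+2e = trans (sym (ℕ.+-assoc (d ∸ e) e e)) (cong (_+ e) (ℕ.m∸n+n≡m e≤d))
      sums : (d + e) + (d ∸ e) ≡ d + d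
      sums = trans (ℕ.+-assoc d e (d ∸ e)) (cong (d +_) (ℕ.m+[n∸m]≡n e≤d))
      2ⁿ[e+e] : 2 ^ n * (e + e) ≡ 2 ^ suc n * e
      2ⁿ[e+e] = begin
        2 ^ n * (e + e)   ≡⟨ cong (λ i → 2 ^ n * (e + i)) (ℕ.+-identityʳ e) ⟨
        2 ^ n * (2 * e)   ≡⟨ ℕ.*-assoc (2 ^ n) 2 e ⟨
        2 ^ n * 2 * e     ≡⟨ cong (_* e) (ℕ.*-comm (2 ^ n) 2) ⟩
        2 ^ suc n * e     ∎
        where open ≡-Reasoning
      case : Gap m (σ ++ [ false ]) (d + e) ⊎ Gap m (σ ++ [ true ]) (d ∸ e) →
             ∃[ v ] length v ≤ suc n × Gap m (σ ++ v) (d + e)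
      case (inj₁ g₀) = [ false ] , s≤s z≤n , g₀
      case (inj₂ g₁) with thinBlock n {e = e + e} (subst₂ _<_ (sym 2ⁿ[e+e]) (sym d∸e+2e) h) g₁
                            (subst (¬_ ∘ Thick) (sym (++-assoc σ [ true ] _)) thin)
      ... | v , v≤n , g′ = true ∷ v , s≤s v≤n ,
        subst (λ τ → Gap m τ (d + e)) (++-assoc σ [ true ] v) (subst (Gap m _) d∸e+2e g′)

    -- No branch of the tree of thick nodes that passes through σ has 1ⁿ⁺¹ as its k-th block of length n + 1.
    Avoids : ℕ → List Bool → ℕ → Set
    Avoids n σ k = ∀ v → length (σ ++ v) ≡ suc n * suc k → ¬ Thick ((σ ++ v) ++ replicate (suc n) true)

    Avoids-++ : ∀ {n σ k} v → Avoids n σ k → Avoids n (σ ++ v) k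
    Avoids-++ {n} {σ} {k} v av w rewrite ++-assoc σ v w = av (v ++ w)

    -- Extend σ to the start of block k without loss, then gain one unit 1/2^m inside the block by
    -- `thinBlock` with e = 1. The next value is larger, so its block starts no earlier than this
    -- one ends, and the gains accumulate.
    avoidedChain : ∀ {n m d} k ks {σ} → 2 ^ suc n ≤ d → Gap m σ d → length σ ≤ suc n * suc k →
                   Linked _<_ (k ∷ ks) → All (Avoids n σ) (k ∷ ks) →
                   ∃[ τ ] Gap m τ (length (k ∷ ks) + d)
    avoidedChain {n} {m} {d} k ks {σ} 2^n≤d g σ≤ linked (av ∷ avs)
      with Gap-extend {σ = σ} (suc n * suc k ∸ length σ) g
    ... | v , |v| , g₁ = step (thinBlock (suc n) {d = d} {e = 1} 2^n<d+1 g₁ (av v |σv|))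
      where
      2^n<d+1 : 2 ^ suc n * 1 < d + 1
      2^n<d+1 = subst₂ _<_ (sym (ℕ.*-identityʳ (2 ^ suc n))) (ℕ.+-comm 1 d) (s≤s 2^n≤d)
      |σv| : length (σ ++ v) ≡ suc n * suc k
      |σv| = trans (length-++ σ) (trans (cong (length σ +_) |v|) (ℕ.m+[n∸m]≡n σ≤))
      step : ∃[ w ] length w ≤ suc n × Gap m ((σ ++ v) ++ w) (d + 1) → ∃[ τ ] Gap m τ (length (k ∷ ks) + d)
      step (w , w≤n , g₂) = rest ks linked avs
        where
        g₂′ : Gap m ((σ ++ v) ++ w) (suc d)
        g₂′ = subst (Gap m _) (ℕ.+-comm d 1) g₂
        |σvw| : length ((σ ++ v) ++ w) ≤ suc n * suc (suc k)
        |σvw| = begin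
          length ((σ ++ v) ++ w)         ≡⟨ length-++ (σ ++ v) ⟩
          length (σ ++ v) + length w     ≤⟨ ℕ.+-mono-≤ (ℕ.≤-reflexive |σv|) w≤n ⟩
          suc n * suc k + suc n          ≡⟨ ℕ.+-comm (suc n * suc k) (suc n) ⟩
          suc n + suc n * suc k          ≡⟨ ℕ.*-suc (suc n) (suc k) ⟨
          suc n * suc (suc k)            ∎
          where open ℕ.≤-Reasoning
        rest : ∀ ks → Linked _<_ (k ∷ ks) → All (Avoids n σ) ks → ∃[ τ ] Gap m τ (length (k ∷ ks) + d)
        rest []        _ _ = _ , g₂′
        rest (k′ ∷ ks) (k<k′ ∷ l) avs = let τ , g₃ = avoidedChain k′ ks
                                                        (ℕ.≤-trans 2^n≤d (ℕ.n≤1+n d)) g₂′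
                                                        (ℕ.≤-trans |σvw| (ℕ.*-monoʳ-≤ (suc n) (s≤s k<k′))) l
                                                        (All.map (Avoids-++ {n} {σ ++ v} w ∘ Avoids-++ {n} {σ} v) avs)
                                        in τ , subst (Gap m τ) (ℕ.+-suc (length (k′ ∷ ks)) d) g₃

    -- The gap 1/2^(n+1) is rewritten as 2^(n+1)/2^(2n+2), enough for unit gains in blocks of length
    -- n + 1. Each avoided value adds a unit, and no gap exceeds 2^(2n+2) units.
    avoided-AtMost : ∀ n σ → length σ ≡ suc n → Gap (suc n) σ 1 → AtMost (2 ^ (suc n + suc n)) (Avoids n σ)
    avoided-AtMost n σ |σ| g = boundedChains⇒AtMost (2 ^ (suc n + suc n)) chains
      where
      chains : ∀ ks → Linked _<_ ks → All (Avoids n σ) ks → length ks ≤ 2 ^ (suc n + suc n)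
      chains []       _ _ = z≤n
      chains (k ∷ ks) l avs with avoidedChain k ks (subst (2 ^ suc n ≤_) (sym (ℕ.*-identityʳ _)) ℕ.≤-refl)
                                 (Gap-refine (suc n) g) (subst (_≤ suc n * suc k) (sym |σ|) (ℕ.m≤m*n (suc n) (suc k))) l avs
      ... | τ , g′ = ℕ.m+n≤o⇒m≤o _ (Gap-bound g′)

  -- Infinite sequences and their initial segments

  infix 4 _⊏_

  -- For X = ℕ, s ⊏ x is N s x by definition.
  _⊏_ : List X → (ℕ → X) → Set
  s ⊏ x = ∀ (i : Fin (length s)) → lookup s i ≡ x (toℕ i)

  ⊏-++ : ∀ (s : List X) {t x} → s ++ t ⊏ x → s ⊏ x
  ⊏-++ (a ∷ s)         st zero    = st zero
  ⊏-++ (a ∷ s) {x = x} st (suc i) = ⊏-++ s {x = x ∘ suc} (st ∘ suc) i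

  ⊏-∷ʳ : ∀ (s : List X) {a t x} → s ++ a ∷ t ⊏ x → x (length s) ≡ a
  ⊏-∷ʳ []              h = sym (h zero)
  ⊏-∷ʳ (_ ∷ s) {x = x} h = ⊏-∷ʳ s {x = x ∘ suc} (h ∘ suc)

  ⊏-comparable : ∀ (s t : List X) {x} → s ⊏ x → t ⊏ x → length s ≤ length t → ∃[ r ] t ≡ s ++ r
  ⊏-comparable []      t           _  _  _ = t , refl
  ⊏-comparable (a ∷ s) (b ∷ t) {x} sx tx (s≤s s≤t) with ⊏-comparable s t {x ∘ suc} (sx ∘ suc) (tx ∘ suc) s≤t
  ... | r , refl = r , cong (_∷ s ++ r) (trans (tx zero) (sym (sx zero)))

  ⊏-∈ : ∀ {s : List X} {x a} → s ⊏ x → a ∈ᴸ s → ∃[ k ] x k ≡ a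
  ⊏-∈ sx a∈s = toℕ (Any.index a∈s) , trans (sym (sx (Any.index a∈s))) (sym (lookup-index a∈s))

  nth : List X → ℕ → Maybe X
  nth s n = head (drop n s)

  nth-++ : ∀ (s : List X) {t a} n → nth s n ≡ just a → nth (s ++ t) n ≡ just a
  nth-++ (_ ∷ s) zero    eq = eq
  nth-++ (_ ∷ s) (suc n) eq = nth-++ s n eq
  nth-++ []      zero    ()
  nth-++ []      (suc n) ()

  nth-lookup : ∀ (s : List X) i → nth s (toℕ i) ≡ just (lookup s i)
  nth-lookup (a ∷ s) zero    = refl
  nth-lookup (a ∷ s) (suc i) = nth-lookup s i

  nth-< : ∀ (s : List X) n → n < length s → ∃[ a ] nth s n ≡ just a
  nth-< (a ∷ s) zero    _         = a , refl
  nth-< (a ∷ s) (suc n) (s≤s n<s) = nth-< s n n<s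

  nth-applyUpTo : ∀ (x : ℕ → X) {n k} → k < n → nth (applyUpTo x n) k ≡ just (x k)
  nth-applyUpTo x {suc n} {zero}  _         = refl
  nth-applyUpTo x {suc n} {suc k} (s≤s k<n) = nth-applyUpTo (x ∘ suc) k<n

  -- The n-th value is read off s (n + 1), which is long enough; it agrees with s i because both
  -- persist to stage n + 1 + i.
  limit : (s e : ℕ → List X) → (∀ i → s (suc i) ≡ s i ++ e i) → (∀ i → i ≤ length (s i)) →
          ∃[ x ] ∀ i → s i ⊏ x
  limit {X = X} s e step long = proj₁ ∘ value , agrees
    where
    value : ∀ n → ∃[ a ] nth (s (suc n)) n ≡ just a
    value n = nth-< (s (suc n)) n (long (suc n))
    stable : ∀ i k {n a} → nth (s i) n ≡ just a → nth (s (k + i)) n ≡ just a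
    stable i zero    eq = eq
    stable i (suc k) {n} {a} eq = subst (λ t → nth t n ≡ just a) (sym (step (k + i)))
      (nth-++ (s (k + i)) n (stable i k {n} eq))
    agrees : ∀ i → s i ⊏ proj₁ ∘ value
    agrees i j = just-injective (trans (sym (stable i (suc n) {n} (nth-lookup (s i) j)))
      (subst (λ l → nth (s l) n ≡ just (proj₁ (value n))) (ℕ.+-comm i (suc n)) (stable (suc n) i {n} (proj₂ (value n)))))
      where n = toℕ j

  -- Total measure of finite lists of basic open sets

  ∑-suc : ∀ f n → ∑[ suc n ] f ≡ f 0 ℚ.+ ∑[ n ] (f ∘ suc)
  ∑-suc f zero    = ℚ.+-comm 0ℚ (f 0)
  ∑-suc f (suc n) = trans (cong (ℚ._+ f (suc n)) (∑-suc f n)) (ℚ.+-assoc (f 0) (∑[ n ] (f ∘ suc)) (f (suc n)))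

  total : List (List ℕ) → ℚ
  total []      = 0ℚ
  total (s ∷ L) = μN s ℚ.+ total L

  total-++ : ∀ L M → total (L ++ M) ≡ total L ℚ.+ total M
  total-++ []      M = sym (ℚ.+-identityˡ (total M))
  total-++ (s ∷ L) M = trans (cong (μN s ℚ.+_) (total-++ L M)) (sym (ℚ.+-assoc (μN s) (total L) (total M)))

  total-const : ∀ {m} L → All (λ s → μN s ≡ ½^ m) L → total L ≡ length L ·½^ m
  total-const []      []       = refl
  total-const (s ∷ L) (e ∷ es) = cong₂ ℚ._+_ e (total-const L es)

  total-⊏ : ∀ L {x} → L ⊏ x → total L ≡ ∑[ length L ] (μN ∘ x)
  total-⊏ []      _ = refl
  total-⊏ (s ∷ L) {x} h = trans (cong₂ ℚ._+_ (cong μN (h zero)) (total-⊏ L {x ∘ suc} (h ∘ suc)))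
    (sym (∑-suc (μN ∘ x) (length L)))

  bits : ℕ → List (List Bool)
  bits zero    = [ [] ]
  bits (suc n) = map (false ∷_) (bits n) ++ map (true ∷_) (bits n)

  ∈-bits : ∀ v → v ∈ᴸ bits (length v)
  ∈-bits []          = here refl
  ∈-bits (false ∷ v) = ∈-++⁺ˡ (∈-map⁺ (false ∷_) (∈-bits v))
  ∈-bits (true ∷ v)  = ∈-++⁺ʳ (map (false ∷_) (bits (length v))) (∈-map⁺ (true ∷_) (∈-bits v))

  length-bits : ∀ n → length (bits n) ≡ 2 ^ n
  length-bits zero    = refl
  length-bits (suc n) = begin
    length (map (false ∷_) (bits n) ++ map (true ∷_) (bits n)) ≡⟨ length-++ (map (false ∷_) (bits n)) ⟩
    length (map (false ∷_) (bits n)) + length (map (true ∷_) (bits n))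
      ≡⟨ cong₂ _+_ (trans (length-map _ (bits n)) (length-bits n)) (trans (length-map _ (bits n)) (length-bits n)) ⟩
    2 ^ n + 2 ^ n ≡⟨ cong (2 ^ n +_) (ℕ.+-identityʳ (2 ^ n)) ⟨
    2 ^ suc n ∎
    where open ≡-Reasoning

  bits-length : ∀ n → All (λ v → length v ≡ n) (bits n)
  bits-length zero    = refl ∷ []
  bits-length (suc n) = All.++⁺ (All.map⁺ (All.map (cong suc) (bits-length n)))
                                (All.map⁺ (All.map (cong suc) (bits-length n)))

  replicate-∷ʳ : ∀ n (b : Bool) → replicate n b ++ [ b ] ≡ replicate (suc n) b
  replicate-∷ʳ zero    b = refl
  replicate-∷ʳ (suc n) b = cong (b ∷_) (replicate-∷ʳ n b)

  -- Injective codes for finite sequences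

  code-injective : ∀ s t → code s ≡ code t → s ≡ t
  code-injective []          []          _  = refl
  code-injective []          (zero ∷ t)  ()
  code-injective []          (suc l ∷ t) ()
  code-injective (zero ∷ s)  []          ()
  code-injective (suc k ∷ s) []          ()
  code-injective (k ∷ s)     (l ∷ t)     eq = go k l eq
    where
    go : ∀ k l → code (k ∷ s) ≡ code (l ∷ t) → k ∷ s ≡ l ∷ t
    go zero    zero    eq = cong (0 ∷_) (code-injective s t (∷-injectiveʳ eq))
    go zero    (suc l) ()
    go (suc k) zero    ()
    go (suc k) (suc l) eq with go k l (∷-injectiveʳ eq)
    ... | refl = refl

  -- In bijective base 2 every bit string is a numeral, so no leading zeros are lost.
  binary : List Bool → ℕᵇ
  binary []          = 0ᵇ
  binary (true ∷ u)  = 2[1+ binary u ]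
  binary (false ∷ u) = 1+[2 binary u ]

  binary-injective : ∀ u v → binary u ≡ binary v → u ≡ v
  binary-injective []          []          _  = refl
  binary-injective []          (true ∷ v)  ()
  binary-injective []          (false ∷ v) ()
  binary-injective (true ∷ u)  []          ()
  binary-injective (false ∷ u) []          ()
  binary-injective (true ∷ u)  (true ∷ v)  eq = cong (true ∷_) (binary-injective u v (2[1+_]-injective eq))
  binary-injective (false ∷ u) (false ∷ v) eq = cong (false ∷_) (binary-injective u v (1+[2_]-injective eq))

  abstract
    enc : List ℕ → ℕ
    enc = ℕᵇ→ℕ ∘ binary ∘ code

    enc-injective : ∀ {s t} → enc s ≡ enc t → s ≡ t
    enc-injective {s} {t} = code-injective s t ∘ binary-injective (code s) (code t) ∘ ℕᵇ→ℕ-injective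

  pairEnc : List ℕ → List ℕ → ℕ
  pairEnc s t = enc (enc s ∷ enc t ∷ [])

  pairEnc-injective : ∀ {s t s′ t′} → pairEnc s t ≡ pairEnc s′ t′ → s ≡ s′ × t ≡ t′
  pairEnc-injective {s} {t} {s′} {t′} eq =
    enc-injective (∷-injectiveˡ eqs) , enc-injective (∷-injectiveˡ (∷-injectiveʳ eqs))
    where
    eqs : enc s ∷ enc t ∷ [] ≡ enc s′ ∷ enc t′ ∷ []
    eqs = enc-injective eq

  -- Localisation

  -- Its code is v followed by n + 1 ones, the last of which is supplied by `decode`.
  node : ℕ → List Bool → List ℕ
  node n v = proj₁ (decode (v ++ replicate n true))

  code-node : ∀ n v → code (node n v) ≡ v ++ replicate (suc n) true
  code-node n v = trans (proj₂ (decode (v ++ replicate n true)))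
    (trans (++-assoc v (replicate n true) [ true ]) (cong (v ++_) (replicate-∷ʳ n true)))

  node-nonempty : ∀ n v → 1 ≤ length (node n v)
  node-nonempty n v with node n v | code-node n v
  ... | _ ∷ _ | _  = s≤s z≤n
  ... | []    | eq with v | eq
  ...   | []    | ()
  ...   | _ ∷ _ | ()

  -- The k-th block of length n + 1 consists of ones with probability 2^{-(n+1)}; f n selects one of
  -- these independent events for each n, and x ∈ Hits f if infinitely many of the selected ones occur.
  Hits : ωω → Pred ωω 0ℓ
  Hits f x = ∀ m → ∃[ n ] m ≤ n × ∃[ v ] length v ≡ suc n * suc (f n) × x ∈ N (node n v)

  -- Borel-Cantelli: the nodes belonging to n have total measure `½^ (suc n)`, and those with n ≥ m
  -- together have measure `½^ m`.
  Hits-null : ∀ f → Null (Hits f)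
  Hits-null f ε ε>0 = enumerate (½^-archimedean ε ε>0)
    where
    node-μN : ∀ n v → μN (node n v) ≡ ½^ (length v + suc n)
    node-μN n v = trans (μN≡½^code (node n v)) (cong ½^_ (begin
      length (code (node n v))                   ≡⟨ cong length (code-node n v) ⟩
      length (v ++ replicate (suc n) true)       ≡⟨ length-++ v ⟩
      length v + length (replicate (suc n) true) ≡⟨ cong (length v +_) (length-replicate (suc n)) ⟩
      length v + suc n                           ∎))
      where open ≡-Reasoning

    nodes : ℕ → List (List ℕ)
    nodes n = map (node n) (bits (suc n * suc (f n)))

    |nodes| : ∀ n → length (nodes n) ≡ 2 ^ (suc n * suc (f n))
    |nodes| n = trans (length-map (node n) (bits (suc n * suc (f n)))) (length-bits (suc n * suc (f n)))

    nodes-nonempty : ∀ n → 1 ≤ length (nodes n)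
    nodes-nonempty n = subst (1 ≤_) (sym (|nodes| n)) (ℕ.m^n>0 2 (suc n * suc (f n)))

    total-nodes : ∀ n → total (nodes n) ≡ ½^ suc n
    total-nodes n = begin
      total (nodes n)                         ≡⟨ total-const (nodes n) masses ⟩
      length (nodes n) ·½^ (q + suc n)        ≡⟨ cong (_·½^ (q + suc n)) (|nodes| n) ⟩
      (2 ^ q) ·½^ (q + suc n)                 ≡⟨ 2^m·½^[m+n]≡½^n q (suc n) ⟩
      ½^ suc n                                ∎
      where
      open ≡-Reasoning
      q = suc n * suc (f n)
      node-mass : ∀ v → length v ≡ q → μN (node n v) ≡ ½^ (q + suc n)
      node-mass v e = trans (node-μN n v) (cong (λ l → ½^ (l + suc n)) e)
      masses : All (λ s → μN s ≡ ½^ (q + suc n)) (nodes n)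
      masses = All.map⁺ (All.map (λ {v} → node-mass v) (bits-length q))

    enumerate : ∃[ m ] ½^ m ℚ.≤ ε →
                Σ[ s ∈ (ℕ → List ℕ) ] Hits f ⊆ ⋃ ℕ (λ k → N (s k)) × (∀ n → ∑[ n ] (λ k → μN (s k)) ℚ.≤ ε)
    enumerate (m , ½^m≤ε) = s , (λ {x} → covers {x}) , small
      where
      initial : ℕ → List (List ℕ)
      initial zero    = []
      initial (suc i) = initial i ++ nodes (i + m)

      initial-long : ∀ i → i ≤ length (initial i)
      initial-long zero    = z≤n
      initial-long (suc i) = begin
        suc i                                       ≡⟨ ℕ.+-comm 1 i ⟩
        i + 1                                       ≤⟨ ℕ.+-mono-≤ (initial-long i) (nodes-nonempty (i + m)) ⟩
        length (initial i) + length (nodes (i + m)) ≡⟨ length-++ (initial i) ⟨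
        length (initial i ++ nodes (i + m))         ∎
        where open ℕ.≤-Reasoning

      -- The second summand is the mass of the nodes still to be listed.
      total-initial : ∀ i → total (initial i) ℚ.+ ½^ (i + m) ≡ ½^ m
      total-initial zero    = ℚ.+-identityˡ (½^ m)
      total-initial (suc i) = begin
        total (initial i ++ nodes (i + m)) ℚ.+ ½^ suc (i + m)
          ≡⟨ cong (ℚ._+ ½^ suc (i + m)) (total-++ (initial i) (nodes (i + m))) ⟩
        (total (initial i) ℚ.+ total (nodes (i + m))) ℚ.+ ½^ suc (i + m)
          ≡⟨ ℚ.+-assoc (total (initial i)) (total (nodes (i + m))) (½^ suc (i + m)) ⟩
        total (initial i) ℚ.+ (total (nodes (i + m)) ℚ.+ ½^ suc (i + m))
          ≡⟨ cong (λ q → total (initial i) ℚ.+ (q ℚ.+ ½^ suc (i + m))) (total-nodes (i + m)) ⟩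
        total (initial i) ℚ.+ (½^ suc (i + m) ℚ.+ ½^ suc (i + m))
          ≡⟨ cong (total (initial i) ℚ.+_) (½^-halves (i + m)) ⟩
        total (initial i) ℚ.+ ½^ (i + m)
          ≡⟨ total-initial i ⟩
        ½^ m ∎
        where open ≡-Reasoning

      s : ℕ → List ℕ
      s = proj₁ (limit initial (λ i → nodes (i + m)) (λ _ → refl) initial-long)

      initial-⊏ : ∀ i → initial i ⊏ s
      initial-⊏ = proj₂ (limit initial (λ i → nodes (i + m)) (λ _ → refl) initial-long)

      -- The list `initial n` has at least n entries, so its total dominates the n-th partial sum.
      small : ∀ n → ∑[ n ] (μN ∘ s) ℚ.≤ ε
      small n = begin
        ∑[ n ] (μN ∘ s)                                          ≤⟨ ∑-mono (μN-nonNeg ∘ s) n (length (initial n) ∸ n) ⟩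
        ∑[ length (initial n) ∸ n + n ] (μN ∘ s)                 ≡⟨ cong (λ l → ∑[ l ] (μN ∘ s)) (ℕ.m∸n+n≡m (initial-long n)) ⟩
        ∑[ length (initial n) ] (μN ∘ s)                         ≡⟨ total-⊏ (initial n) {s} (initial-⊏ n) ⟨
        total (initial n)                                        ≤⟨ p≤p+q _ (½^-nonNeg (n + m)) ⟩
        total (initial n) ℚ.+ ½^ (n + m)                         ≡⟨ total-initial n ⟩
        ½^ m                                                     ≤⟨ ½^m≤ε ⟩
        ε                                                        ∎
        where open ℚ.≤-Reasoning

      covers : Hits f ⊆ ⋃ ℕ (λ k → N (s k))
      covers {x} h with h m
      ... | n , m≤n , v , |v| , x∈ = proj₁ sk , subst (λ t → x ∈ N t) (sym (proj₂ sk)) x∈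
        where
        v∈ : node n v ∈ᴸ nodes n
        v∈ = ∈-map⁺ (node n) (subst (λ l → v ∈ᴸ bits l) |v| (∈-bits v))
        sk : ∃[ k ] s k ≡ node n v
        sk = ⊏-∈ {x = s} (initial-⊏ (suc (n ∸ m)))
          (∈-++⁺ʳ (initial (n ∸ m)) (subst (λ l → node n v ∈ᴸ nodes l) (sym (ℕ.m∸n+n≡m m≤n)) v∈))

  -- The number of words σ of length n + 1, times the bound on the values avoided below each.
  width : ℕ → ℕ
  width n = 2 ^ suc n * 2 ^ (suc n + suc n)

  module Localisation (t : ℕ → List ℕ) (small : ∀ n → ∑[ n ] (λ k → μN (t k)) ℚ.≤ ½) where

    open Thickness (code ∘ t)
    open Gap

    -- Length and gap of σ are both tied to n: this leaves finitely many σ for each n, while any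
    -- given thick node has an extension of this kind for all large n.
    Admissible : ℕ → List Bool → Pred ℕ 0ℓ
    Admissible n σ k = length σ ≡ suc n × Gap (suc n) σ 1 × Avoids n σ k

    Localised : ℕ → Pred ℕ 0ℓ
    Localised n k = ∃[ σ ] σ ∈ᴸ bits (suc n) × Admissible n σ k

    Localised-AtMost : ∀ n → AtMost (width n) (Localised n)
    Localised-AtMost n = subst (λ l → AtMost (l * 2 ^ (suc n + suc n)) (Localised n)) (length-bits (suc n))
      (AtMost-∪ admissible (bits (suc n)))
      where
      admissible : ∀ σ → AtMost (2 ^ (suc n + suc n)) (Admissible n σ)
      admissible σ with em {P = length σ ≡ suc n × Gap (suc n) σ 1}
      ... | yes (|σ| , g) = AtMost-⊆ (λ _ → proj₂ ∘ proj₂) (avoided-AtMost n σ |σ| g)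
      ... | no ¬p         = [] , z≤n , λ k → λ { (|σ| , g , _) → contradiction (|σ| , g) ¬p }

    root-thick : Thick []
    -- The cover has total measure at most 1/2, so the fraction 1/2^1 is left.
    root-thick = 1 , gap λ n → begin
      covered n [] ℚ.+ 1 ·½^ 1  ≡⟨ cong (ℚ._+ 1 ·½^ 1) (∑-cong share-code n) ⟩
      ∑[ n ] (μN ∘ t) ℚ.+ 1 ·½^ 1 ≤⟨ ℚ.+-monoˡ-≤ (1 ·½^ 1) (small n) ⟩
      ½ ℚ.+ 1 ·½^ 1               ≡⟨⟩
      1ℚ                          ∎
      where
      open ℚ.≤-Reasoning
      share-code : ∀ k → share (code (t k)) [] ≡ μN (t k)
      share-code k = trans (share-[] (code (t k))) (sym (μN≡½^code (t k)))

    -- Inside N (t k) the k-th set alone has share 1, so no gap remains.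
    covered-thin : ∀ k r → ¬ Thick (code (t k) ++ r)
    covered-thin k r (m , g) = ℚ.<-irrefl refl (begin-strict
      1ℚ                                            ≡⟨ share-prefix (code (t k)) r ⟨
      share (code (t k)) (code (t k) ++ r)          ≡⟨ ℚ.+-identityˡ _ ⟨
      0ℚ ℚ.+ share (code (t k)) (code (t k) ++ r)   ≤⟨ ℚ.+-monoˡ-≤ _ (covered-nonNeg k (code (t k) ++ r)) ⟩
      covered (suc k) (code (t k) ++ r)             ≡⟨ ℚ.+-identityʳ _ ⟨
      covered (suc k) (code (t k) ++ r) ℚ.+ 0ℚ      <⟨ ℚ.+-monoʳ-< (covered (suc k) (code (t k) ++ r)) 0<1·½^m ⟩
      covered (suc k) (code (t k) ++ r) ℚ.+ 1 ·½^ m ≤⟨ g .below (suc k) ⟩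
      1ℚ                                            ∎)
      where
      open ℚ.≤-Reasoning
      0<1·½^m : 0ℚ ℚ.< 1 ·½^ m
      0<1·½^m = ℚ.<-≤-trans (½^-pos m) (p≤p+q (½^ m) ℚ.≤-refl)

    module _ (f : ωω) (Hits⊆ : Hits f ⊆ ⋃ ℕ (λ k → N (t k))) where

      Hit : ℕ → List Bool → Set
      Hit m σ = ∃[ n ] m ≤ n × ∃[ v ] length (σ ++ v) ≡ suc n * suc (f n) ×
                Thick ((σ ++ v) ++ replicate (suc n) true)

      private
        EventuallyLocalised = ∃[ m ] ∀ n → m ≤ n → Localised n (f n)

      -- Suppose the fraction `½^ j` of [σ] is uncovered and no n ≥ m gives a hit below σ. For n ≥ m
      -- + j + |σ|, an extension of σ to length n + 1 that keeps the gap then witnesses that f n is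
      -- localised.
      ¬localised⇒hit : ¬ EventuallyLocalised → ∀ m σ → Thick σ → Hit m σ
      ¬localised⇒hit ¬loc m σ (j , g) = dne λ ¬hit → ¬loc (m + (j + length σ) , λ n M≤n →
        let m≤n  = ℕ.m+n≤o⇒m≤o m M≤n
            jσ≤n = ℕ.m+n≤o⇒n≤o m M≤n
            j≤n  = ℕ.m+n≤o⇒m≤o j jσ≤n
            σ≤n  = ℕ.m+n≤o⇒n≤o j jσ≤n
            v , |v| , g′ = Gap-extend {σ = σ} (suc n ∸ length σ) (Gap-weaken (ℕ.m≤n⇒m≤1+n j≤n) g)
            |σv| = trans (length-++ σ) (trans (cong (length σ +_) |v|) (ℕ.m+[n∸m]≡n (ℕ.m≤n⇒m≤1+n σ≤n)))
            avoids = λ w eq thick → ¬hit (n , m≤n , v ++ w ,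
                       trans (cong length (sym (++-assoc σ v w))) eq ,
                       subst (λ τ → Thick (τ ++ replicate (suc n) true)) (++-assoc σ v w) thick)
        in σ ++ v , subst (λ l → σ ++ v ∈ᴸ bits l) |σv| (∈-bits (σ ++ v)) , |σv| , g′ , avoids)

      -- Otherwise hits can be appended forever through thick nodes. The limit lies in `Hits f`,
      -- hence in some N (t k), although its long initial segments are thick.
      localised : EventuallyLocalised
      localised = dne λ ¬loc → ⊥-elim (contra ¬loc)
        where
        module _ (¬loc : ¬ EventuallyLocalised) where
          hit : ∀ m s → Thick (code s) → Hit m (code s)
          hit m s = ¬localised⇒hit ¬loc m (code s)

          code-++-node : ∀ s n v → code (s ++ node n v) ≡ (code s ++ v) ++ replicate (suc n) true
          code-++-node s n v = trans (code-++ s (node n v))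
            (trans (cong (code s ++_) (code-node n v)) (sym (++-assoc (code s) v _)))

          extend : ∀ m (s : Σ[ s ∈ List ℕ ] Thick (code s)) → Hit m (code (proj₁ s)) → Σ[ s ∈ List ℕ ] Thick (code s)
          extend m (s , _) (n , _ , v , _ , thick) = s ++ node n v , subst Thick (sym (code-++-node s n v)) thick

          branch : ℕ → Σ[ s ∈ List ℕ ] Thick (code s)
          branch zero    = [] , root-thick
          branch (suc m) = extend m (branch m) (hit m (proj₁ (branch m)) (proj₂ (branch m)))

          hitAt : ∀ m → Hit m (code (proj₁ (branch m)))
          hitAt m = hit m (proj₁ (branch m)) (proj₂ (branch m))

          initial added : ℕ → List ℕ
          initial m = proj₁ (branch m)
          added m   = node (proj₁ (hitAt m)) (proj₁ (proj₂ (proj₂ (hitAt m))))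

          added-nonempty : ∀ m → 1 ≤ length (added m)
          added-nonempty m = node-nonempty (proj₁ (hitAt m)) (proj₁ (proj₂ (proj₂ (hitAt m))))

          initial-long : ∀ m → m ≤ length (initial m)
          initial-long zero    = z≤n
          initial-long (suc m) = begin
            suc m                               ≡⟨ ℕ.+-comm 1 m ⟩
            m + 1                               ≤⟨ ℕ.+-mono-≤ (initial-long m) (added-nonempty m) ⟩
            length (initial m) + length (added m) ≡⟨ length-++ (initial m) ⟨
            length (initial (suc m))            ∎
            where open ℕ.≤-Reasoning

          x : ωω
          x = proj₁ (limit initial added (λ _ → refl) initial-long)

          initial-⊏ : ∀ m → x ∈ N (initial m)
          initial-⊏ = proj₂ (limit initial added (λ _ → refl) initial-long)

          x∈Hits : x ∈ Hits f
          x∈Hits m = proj₁ h , proj₁ (proj₂ h) , v , proj₁ (proj₂ (proj₂ (proj₂ h))) ,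
            subst (λ s → x ∈ N s) same (initial-⊏ (suc m))
            where
            h = hitAt m
            -- `Hits` wants the whole word before the ones, counted from the root, so the code of
            -- `initial m` is put in front.
            v = code (initial m) ++ proj₁ (proj₂ (proj₂ h))
            same : initial (suc m) ≡ node (proj₁ h) v
            same = code-injective _ _ (trans (code-++-node (initial m) _ _) (sym (code-node (proj₁ h) v)))

          contra : ⊥
          contra = let k , x∈ = Hits⊆ {x} x∈Hits
                       l = length (t k)
                       r , eq = ⊏-comparable (t k) (initial l) {x} x∈ (initial-⊏ l) (initial-long l)
                   in covered-thin k (code r) (subst Thick (trans (cong code eq) (code-++ (t k) r)) (proj₂ (branch l)))

  -- Slaloms

  insert : ℕ → List ℕ → List ℕ
  insert a []       = [ a ]
  insert a (b ∷ bs) with ℕ.<-cmp a b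
  ... | tri< _ _ _ = a ∷ b ∷ bs
  ... | tri≈ _ _ _ = b ∷ bs
  ... | tri> _ _ _ = b ∷ insert a bs

  insert-linked : ∀ {a b} bs → b < a → Linked _<_ (b ∷ bs) → Linked _<_ (b ∷ insert a bs)
  insert-linked []       b<a _ = b<a ∷ [-]
  insert-linked {a} (c ∷ cs) b<a (b<c ∷ l) with ℕ.<-cmp a c
  ... | tri< a<c _ _ = b<a ∷ a<c ∷ l
  ... | tri≈ _ _ _   = b<c ∷ l
  ... | tri> _ _ c<a = b<c ∷ insert-linked cs c<a l

  linked-insert : ∀ a bs → Linked _<_ bs → Linked _<_ (insert a bs)
  linked-insert a []       _ = [-]
  linked-insert a (b ∷ bs) l with ℕ.<-cmp a b
  ... | tri< a<b _ _ = a<b ∷ l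
  ... | tri≈ _ _ _   = l
  ... | tri> _ _ b<a = insert-linked bs b<a l

  length-insert : ∀ a bs → length (insert a bs) ≤ suc (length bs)
  length-insert a []       = ℕ.≤-refl
  length-insert a (b ∷ bs) with ℕ.<-cmp a b
  ... | tri< _ _ _ = ℕ.≤-refl
  ... | tri≈ _ _ _ = ℕ.n≤1+n _
  ... | tri> _ _ _ = s≤s (length-insert a bs)

  ∈-insert : ∀ {k} a bs → k ∈ᴸ a ∷ bs → k ∈ᴸ insert a bs
  ∈-insert a []       k∈ = k∈
  ∈-insert a (b ∷ bs) k∈ with ℕ.<-cmp a b
  ... | tri< _ _ _ = k∈
  ∈-insert a (b ∷ bs) (here refl) | tri≈ _ refl _ = here refl
  ∈-insert a (b ∷ bs) (there k∈)  | tri≈ _ _ _ = k∈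
  ∈-insert a (b ∷ bs) (here refl) | tri> _ _ _ = there (∈-insert a bs (here refl))
  ∈-insert a (b ∷ bs) (there (here refl)) | tri> _ _ _ = here refl
  ∈-insert a (b ∷ bs) (there (there k∈)) | tri> _ _ _ = there (∈-insert a bs (there k∈))

  linked-foldr-insert : ∀ L → Linked _<_ (foldr insert [] L)
  linked-foldr-insert []      = []
  linked-foldr-insert (a ∷ L) = linked-insert a _ (linked-foldr-insert L)

  fromList : List ℕ → FinSet
  fromList L = finSet (foldr insert [] L) (linked-foldr-insert L)

  card-fromList : ∀ L → card (fromList L) ≤ length L
  card-fromList []      = z≤n
  card-fromList (a ∷ L) = ℕ.≤-trans (length-insert a (foldr insert [] L)) (s≤s (card-fromList L))

  ∈-fromList : ∀ {k L} → k ∈ᴸ L → k ∈ᴸ elements (fromList L)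
  ∈-fromList {L = a ∷ L} (here refl) = ∈-insert a (foldr insert [] L) (here refl)
  ∈-fromList {L = a ∷ L} (there k∈)  = ∈-insert a (foldr insert [] L) (there (∈-fromList {L = L} k∈))

  -- The values f(n) with h(j) ≤ n < h(j+1) are read off the code of f ↾ h(j+1), for which there are at
  -- most h(j) ≤ n candidates.
  module Reparametrisation (h : ℕ → ℕ) (h-step : ∀ j → h j < h (suc j)) where

    h-mono : ∀ {i j} → i ≤ j → h i ≤ h j
    h-mono {i} {j} i≤j = subst (λ l → h i ≤ h l) (ℕ.m∸n+n≡m i≤j) (go (j ∸ i))
      where
      go : ∀ r → h i ≤ h (r + i)
      go zero    = ℕ.≤-refl
      go (suc r) = ℕ.≤-trans (go r) (ℕ.<⇒≤ (h-step (r + i)))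

    level : ∀ n → n < h 0 ⊎ ∃[ j ] h j ≤ n × n < h (suc j)
    level zero with h 0 in eq
    ... | zero  = inj₂ (0 , ℕ.≤-reflexive eq , subst (_< h 1) eq (h-step 0))
    ... | suc _ = inj₁ (s≤s z≤n)
    level (suc n) with level n
    ... | inj₁ n<h0 with ℕ.m≤n⇒m<n∨m≡n n<h0
    ...   | inj₁ sn<h0 = inj₁ sn<h0
    ...   | inj₂ sn≡h0 = inj₂ (0 , ℕ.≤-reflexive (sym sn≡h0) , subst (_< h 1) (sym sn≡h0) (h-step 0))
    level (suc n) | inj₂ (j , hj≤n , n<hsj) with ℕ.m≤n⇒m<n∨m≡n n<hsj
    ...   | inj₁ sn<  = inj₂ (j , ℕ.m≤n⇒m≤1+n hj≤n , sn<)
    ...   | inj₂ sn≡  = inj₂ (suc j , ℕ.≤-reflexive (sym sn≡) , subst (_< h (suc (suc j))) (sym sn≡) (h-step (suc j)))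

    valueAt : ℕ → ℕ → ℕ
    valueAt n k with em {P = ∃[ s ] enc s ≡ k}
    ... | yes (s , _) = fromMaybe 0 (nth s n)
    ... | no _        = 0

    valueAt-enc : ∀ n s → valueAt n (enc s) ≡ fromMaybe 0 (nth s n)
    valueAt-enc n s with em {P = ∃[ t ] enc t ≡ enc s}
    ... | yes (t , eq) = cong (λ r → fromMaybe 0 (nth r n)) (enc-injective eq)
    ... | no ∄t        = contradiction (s , refl) ∄t

    blocks : ωω → ωω
    blocks f j = enc (applyUpTo f (h (suc j)))

    module _ (S : ℕ → Pred ℕ 0ℓ) (S-AtMost : ∀ j → AtMost (h j) (S j)) where

      members : ∀ n → n < h 0 ⊎ ∃[ j ] h j ≤ n × n < h (suc j) → List ℕ
      -- These are only finitely many n, so missing the value there does no harm.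
      members n (inj₁ _)       = []
      members n (inj₂ (j , _)) = map (valueAt n) (proj₁ (S-AtMost j))

      members-length : ∀ n l → length (members n l) ≤ n
      members-length n (inj₁ _) = z≤n
      members-length n (inj₂ (j , hj≤n , _)) = subst (_≤ n) (sym (length-map (valueAt n) (proj₁ (S-AtMost j))))
        (ℕ.≤-trans (proj₁ (proj₂ (S-AtMost j))) hj≤n)

      narrow : Slalom
      narrow = slalom (λ n → fromList (members n (level n)))
                      (λ n → ℕ.≤-trans (card-fromList (members n (level n))) (members-length n (level n)))

      narrow-captures : ∀ f → ∀∞ (λ j → S j (blocks f j)) → f ⟦ ∈* ⟧ narrow
      narrow-captures f (m , captured) = h m , λ n hm≤n → ∈-fromList (member n hm≤n (level n))
        where
        member : ∀ n → h m ≤ n → (l : n < h 0 ⊎ ∃[ j ] h j ≤ n × n < h (suc j)) → f n ∈ᴸ members n l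
        member n hm≤n (inj₁ n<h0) = contradiction (ℕ.≤-trans (h-mono z≤n) hm≤n) (ℕ.<⇒≱ n<h0)
        member n hm≤n (inj₂ (j , hj≤n , n<hsj)) = subst (_∈ᴸ map (valueAt n) (proj₁ (S-AtMost j)))
          (trans (valueAt-enc n (applyUpTo f (h (suc j)))) (cong (fromMaybe 0) (nth-applyUpTo f n<hsj)))
          (∈-map⁺ (valueAt n) (proj₂ (proj₂ (S-AtMost j)) _ (captured j m≤j)))
          where
          m≤j : m ≤ j
          m≤j = ℕ.≮⇒≥ λ j<m → ℕ.<⇒≱ n<hsj (ℕ.≤-trans (h-mono j<m) hm≤n)

  -- Small index sets and additivity of the null ideal

  Small : Set → Set
  Small I = ¬ (𝔠 ≼ setoid I)

  Small-↣ : ∀ {I J : Set} (φ : I → J) → (∀ {i j} → φ i ≡ φ j → i ≡ j) → Small J → Small I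
  Small-↣ φ φ-inj small inj = small (mk↣ {to = φ ∘ to} (injective ∘ φ-inj))
    where open Injection inj using (to; injective)

  Null-⊆ : ∀ {a b} {X : Pred ωω a} {Y : Pred ωω b} → X ⊆ Y → Null Y → Null X
  Null-⊆ X⊆Y nullY ε ε>0 = let s , Y⊆ , small = nullY ε ε>0 in s , (λ x∈X → Y⊆ (X⊆Y x∈X)) , small

  width-step : ∀ n → width n < width (suc n)
  width-step n = ℕ.*-mono-< {2 ^ suc n} {2 ^ suc (suc n)} {2 ^ (suc n + suc n)} {2 ^ (suc (suc n) + suc (suc n))}
    (ℕ.^-monoʳ-< 2 (s≤s (s≤s z≤n)) (ℕ.n<1+n (suc n)))
    (ℕ.^-monoʳ-< 2 (s≤s (s≤s z≤n)) (ℕ.+-mono-< (ℕ.n<1+n (suc n)) (ℕ.n<1+n (suc n))))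

  module _ {I : Set} (F : I → ωω) (t : ℕ → List ℕ) (small : ∀ n → ∑[ n ] (λ k → μN (t k)) ℚ.≤ ½) where

    open Reparametrisation width width-step
    open Localisation t small

    -- Localising the block codes of F i leaves `width j` candidates for block j; reparametrising
    -- along `width` turns this into at most n candidates for F i n.
    localiseCover : (∀ i → Hits (blocks (F i)) ⊆ ⋃ ℕ (λ k → N (t k))) → Σ[ s ∈ Slalom ] ∀ i → F i ⟦ ∈* ⟧ s
    localiseCover covers = narrow Localised Localised-AtMost ,
      λ i → narrow-captures Localised Localised-AtMost (F i) (localised (blocks (F i)) (λ {x} → covers i {x}))

  module AdditivityOfNull (add𝒩≡𝔠 : add𝒩-is 𝔠) where

    -- A non-null union would give an injection of 2^ω into the family. Sending each member to an
    -- index of it is injective up to extensional equality, so 2^ω would inject into I.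
    ⋃-null : ∀ {I : Set} → Small I → (X : I → Pred ωω 0ℓ) → (∀ i → Null (X i)) → Null (⋃ I X)
    ⋃-null {I} small X nullX = Null-⊆ (λ { (i , x∈) → X i , (i , (λ z → z) , (λ z → z)) , x∈ }) (dne λ ¬null →
      let large = proj₂ add𝒩≡𝔠 𝓕 (𝓕-null , ¬null)
          open Injection large
      in small (mk↣ {to = proj₁ ∘ proj₂ ∘ to} λ {b} {c} eq → injective
           (same (proj₂ (proj₂ (to b))) (subst (λ i → proj₁ (to c) ≐ X i) (sym eq) (proj₂ (proj₂ (to c)))))))
      where
      𝓕 : Pred (Pred ωω 0ℓ) 0ℓ
      𝓕 Y = ∃[ i ] Y ≐ X i
      𝓕-null : ∀ Y → Y ∈ 𝓕 → Null Y
      𝓕-null Y (i , Y⊆ , _) = Null-⊆ Y⊆ (nullX i)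
      same : ∀ {Y Z V : Pred ωω 0ℓ} → Y ≐ V → Z ≐ V → Y ≐ Z
      same (Y⊆ , ⊆Y) (Z⊆ , ⊆Z) = ⊆Z ∘ Y⊆ , ⊆Y ∘ Z⊆

    -- The minimum in `add𝒩-is` is attained by a family whose union is not null.
    U-not-null : ¬ Null {0ℓ} U
    U-not-null null = let (A , (_ , ¬null) , _) , _ = add𝒩≡𝔠 in ¬null (Null-⊆ _ null)

    -- Bartoszyński's theorem: one cover of measure at most 1/2 serves the null sets of all F i at
    -- once.
    localise : ∀ {I : Set} → Small I → (F : I → ωω) → Σ[ s ∈ Slalom ] ∀ i → F i ⟦ ∈* ⟧ s
    localise small F =
      let t , covers , t-small = ⋃-null small (Hits ∘ blocks ∘ F) (λ i → Hits-null (blocks (F i))) ½ (½^-pos 1)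
      in localiseCover F t t-small (λ i {x} x∈ → covers {x} (i , x∈))
      where open Reparametrisation width width-step

  -- The ideals

  applyUpTo-⊏ : ∀ {X : Set} (x : ℕ → X) n → applyUpTo x n ⊏ x
  applyUpTo-⊏ x n = lookup-applyUpTo x n

  applyUpTo-agree : ∀ {X : Set} (x y : ℕ → X) {n k} → applyUpTo x n ⊏ y → k < n → y k ≡ x k
  applyUpTo-agree x y {suc n} {zero}  h _         = sym (h zero)
  applyUpTo-agree x y {suc n} {suc k} h (s≤s k<n) = applyUpTo-agree (x ∘ suc) (y ∘ suc) (h ∘ suc) k<n

  ⊏-agree : ∀ {X : Set} (s : List X) {x y n} → s ⊏ x → s ⊏ y → n < length s → x n ≡ y n
  ⊏-agree (a ∷ s) {n = zero}  sx sy _         = trans (sym (sx zero)) (sy zero)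
  ⊏-agree (a ∷ s) {x} {y} {suc n} sx sy (s≤s n<) = ⊏-agree s {x ∘ suc} {y ∘ suc} (sx ∘ suc) (sy ∘ suc) n<

  path : ∀ {X : Set} (P : List X → Set) → P [] → (∀ s → P s → ∃[ a ] P (s ++ [ a ])) →
         ∃[ x ] ∀ n → ∃[ s ] length s ≡ n × s ⊏ x × P s
  path {X} P p[] step = proj₁ lim , λ n → initial n , |initial| n , proj₂ lim n , proj₂ (branch n)
    where
    next : Σ[ s ∈ List X ] P s → Σ[ s ∈ List X ] P s
    next (s , p) = s ++ [ proj₁ (step s p) ] , proj₂ (step s p)
    branch : ℕ → Σ[ s ∈ List X ] P s
    branch zero    = [] , p[]
    branch (suc n) = next (branch n)
    initial : ℕ → List X
    initial n = proj₁ (branch n)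
    |initial| : ∀ n → length (initial n) ≡ n
    |initial| zero    = refl
    |initial| (suc n) = trans (length-++ (initial n)) (trans (ℕ.+-comm _ 1) (cong suc (|initial| n)))
    lim : ∃[ x ] ∀ n → initial n ⊏ x
    lim = limit initial (λ n → [ proj₁ (step _ (proj₂ (branch n))) ]) (λ _ → refl)
                (λ n → ℕ.≤-reflexive (sym (|initial| n)))

  length≤length-code : ∀ s → length s ≤ length (code s)
  length≤length-code []      = z≤n
  length≤length-code (k ∷ s) = begin
    suc (length s)                                   ≤⟨ s≤s (length≤length-code s) ⟩
    length (true ∷ code s)                           ≤⟨ ℕ.m≤n+m _ (length (replicate k false)) ⟩
    length (replicate k false) + length (true ∷ code s) ≡⟨ length-++ (replicate k false) ⟨
    length (code (k ∷ s))                            ∎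
    where open ℕ.≤-Reasoning

  μN≤½^length : ∀ s → μN s ℚ.≤ ½^ length s
  μN≤½^length s = subst₂ ℚ._≤_ (trans (cong ½^_ (ℕ.m∸n+n≡m (length≤length-code s))) (sym (μN≡½^code s))) refl
                    (½^-anti (length s) (length (code s) ∸ length s))

  singleton-null : ∀ x → Null (λ y → x ≡ y)
  singleton-null x ε ε>0 = let m , ½^m≤ε = ½^-archimedean ε ε>0 in
    -- The k-th neighbourhood of x has measure at most `½^ (suc (k + m))`, and these bounds add up
    -- to `½^ m`.
    (λ k → applyUpTo x (suc (k + m))) , (λ { refl → 0 , applyUpTo-⊏ x (suc m) }) ,
    λ n → ℚ.≤-trans (ℚ.≤-trans (p≤p+q _ (½^-nonNeg (n + m))) (partial m n)) ½^m≤ε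
    where
    partial : ∀ m n → ∑[ n ] (λ k → μN (applyUpTo x (suc (k + m)))) ℚ.+ ½^ (n + m) ℚ.≤ ½^ m
    partial m zero    = ℚ.≤-reflexive (ℚ.+-identityˡ (½^ m))
    partial m (suc n) = begin
      (∑n ℚ.+ μN (applyUpTo x (suc (n + m)))) ℚ.+ ½^ suc (n + m)
        ≤⟨ ℚ.+-monoˡ-≤ (½^ suc (n + m)) (ℚ.+-monoʳ-≤ ∑n
             (subst (λ l → μN s ℚ.≤ ½^ l) (length-applyUpTo x (suc (n + m))) (μN≤½^length s))) ⟩
      (∑n ℚ.+ ½^ suc (n + m)) ℚ.+ ½^ suc (n + m)
        ≡⟨ ℚ.+-assoc ∑n (½^ suc (n + m)) (½^ suc (n + m)) ⟩
      ∑n ℚ.+ (½^ suc (n + m) ℚ.+ ½^ suc (n + m))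
        ≡⟨ cong (∑n ℚ.+_) (½^-halves (n + m)) ⟩
      ∑n ℚ.+ ½^ (n + m)
        ≤⟨ partial m n ⟩
      ½^ m ∎
      where
      open ℚ.≤-Reasoning
      s  = applyUpTo x (suc (n + m))
      ∑n = ∑[ n ] (λ k → μN (applyUpTo x (suc (k + m))))

  ∈⇒≤sum : ∀ {k L} → k ∈ᴸ L → k ≤ sum L
  ∈⇒≤sum {L = a ∷ L} (here refl) = ℕ.m≤m+n a (sum L)
  ∈⇒≤sum {L = a ∷ L} (there k∈)  = ℕ.≤-trans (∈⇒≤sum k∈) (ℕ.m≤n+m (sum L) a)

  -- König's lemma: a node without finite subcover has a child without one, since only z(|s|) + 1
  -- children meet the box. The resulting branch lies in some V i, which contains a whole node of
  -- the branch.
  bounded-compact : ∀ (z : ωω) → Compact (λ x → ∀ n → x n ≤ z n)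
  bounded-compact z I V V-open covers = let is , h = finite in is , λ {x} x≤z → h x (λ ()) x≤z
    where
    FinitelyCovered : List ℕ → Set
    FinitelyCovered s = Σ[ is ∈ List I ] ∀ x → x ∈ N s → (∀ n → x n ≤ z n) → Any (λ i → x ∈ V i) is

    join : ∀ s b → (∀ k → k < b → FinitelyCovered (s ++ [ k ])) →
           Σ[ is ∈ List I ] ∀ x → x ∈ N s → (∀ n → x n ≤ z n) → x (length s) < b → Any (λ i → x ∈ V i) is
    join s zero    _ = [] , λ x _ _ ()
    join s (suc b) c with join s b (λ k k<b → c k (ℕ.m≤n⇒m≤1+n k<b)) | c b ℕ.≤-refl
    ... | is , h | js , g = is ++ js , both
      where
      snoc : ∀ s {k x} → x ∈ N s → x (length s) ≡ k → x ∈ N (s ++ [ k ])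
      snoc []      x∈ eq zero    = sym eq
      snoc (_ ∷ s) x∈ eq zero    = x∈ zero
      snoc (_ ∷ s) {x = x} x∈ eq (suc i) = snoc s {x = x ∘ suc} (x∈ ∘ suc) eq i
      both : ∀ x → x ∈ N s → (∀ n → x n ≤ z n) → x (length s) < suc b → Any (λ i → x ∈ V i) (is ++ js)
      both x x∈ x≤z x<b with ℕ.m≤n⇒m<n∨m≡n (ℕ.s≤s⁻¹ x<b)
      ... | inj₁ x<b = ++⁺ˡ (h x x∈ x≤z x<b)
      ... | inj₂ x≡b = ++⁺ʳ is (g x (snoc s {x = x} x∈ x≡b) x≤z)

    step : ∀ s → ¬ FinitelyCovered s → ∃[ k ] ¬ FinitelyCovered (s ++ [ k ])
    step s ¬fc = dne λ ∄k → ¬fc (widen (join s (suc (z (length s))) (λ k _ → dne λ ¬fck → ∄k (k , ¬fck))))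
      where
      widen : Σ[ is ∈ List I ] (∀ x → x ∈ N s → (∀ n → x n ≤ z n) → x (length s) < suc (z (length s)) →
                                Any (λ i → x ∈ V i) is) →
              FinitelyCovered s
      widen (is , h) = is , λ x x∈ x≤z → h x x∈ x≤z (s≤s (x≤z (length s)))

    inhabited : ∀ s → ¬ FinitelyCovered s → ∃[ x ] x ∈ N s × ∀ n → x n ≤ z n
    inhabited s ¬fc = dne λ ∄x → ¬fc ([] , λ x x∈ x≤z → contradiction (x , x∈ , x≤z) ∄x)

    contra : ¬ (∃[ x ] ∀ n → ∃[ s ] length s ≡ n × x ∈ N s × ¬ FinitelyCovered s)
    contra (x , branch) = uncovered (covers {x} x≤z)
      where
      x≤z : ∀ n → x n ≤ z n
      -- The children were chosen without regard to z, but a node without finite subcover contains a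
      -- point of the box.
      x≤z n with branch (suc n)
      ... | s , |s| , x∈ , ¬fc with inhabited s ¬fc
      ... | y , y∈ , y≤z = subst (_≤ z n) (⊏-agree s {y} {x} y∈ x∈ (ℕ.≤-reflexive (sym |s|))) (y≤z n)
      uncovered : ¬ (∃[ i ] x ∈ V i)
      uncovered (i , x∈V) with V-open i x∈V
      ... | t , x∈t , t⊆ with branch (length t)
      ... | s , |s| , x∈s , ¬fc with ⊏-comparable t s {x} x∈t x∈s (ℕ.≤-reflexive (sym |s|))
      ... | r , refl = ¬fc ([ i ] , λ y y∈ _ → here (t⊆ (⊏-++ t {x = y} y∈)))

    finite : FinitelyCovered []
    finite = dne λ ¬fc → contra (path (¬_ ∘ FinitelyCovered) ¬fc step)

  pad : List ℕ → ωω
  pad s n = fromMaybe 0 (nth s n)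

  pad-⊏ : ∀ s → pad s ∈ N s
  pad-⊏ (a ∷ s) zero    = refl
  pad-⊏ (a ∷ s) (suc i) = pad-⊏ s i

  dense⇒unbounded : ∀ {F s} b → N s ⊆ Closure F → ∃[ x ] x ∈ F × x (length s) ≡ suc b
  dense⇒unbounded {F} {s} b s⊆ = split-off (s⊆ {pad t} (⊏-++ s {x = pad t} (pad-⊏ t)) t (pad-⊏ t))
    where
    t = s ++ [ suc b ]
    split-off : ∃[ x ] x ∈ N t × x ∈ F → ∃[ x ] x ∈ F × x (length s) ≡ suc b
    split-off (x , x∈t , x∈F) = x , x∈F , ⊏-∷ʳ s {x = x} x∈t

  -- If F were dense in N s, the coordinate at |s| would be unbounded on F; the clopen cover by the
  -- values of this coordinate would then have no finite subcover.
  compact⇒nowhereDense : ∀ {F} → Compact F → NowhereDense F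
  compact⇒nowhereDense {F} compact _ (s , _ , s⊆closure) = contra (compact ℕ V V-open (λ {x} _ → x (length s) , refl))
    where
    V : ℕ → Pred ωω 0ℓ
    V i x = x (length s) ≡ i
    V-open : ∀ i → Open (V i)
    V-open i {x} refl = applyUpTo x (suc (length s)) , applyUpTo-⊏ x (suc (length s)) ,
                        λ {y} y∈ → applyUpTo-agree x y y∈ ℕ.≤-refl
    contra : Σ[ is ∈ List ℕ ] F ⊆ (λ x → Any (λ i → x ∈ V i) is) → ⊥
    contra (is , F⊆) with dense⇒unbounded {F} {s} (sum is) (λ {x} → s⊆closure {x})
    ... | x , x∈F , eq = ℕ.<⇒≱ (ℕ.≤-reflexive (sym eq)) (∈⇒≤sum (F⊆ {x} x∈F))

  σBounded⇒meager : ∀ {X} → σ-Bounded X → Meager X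
  σBounded⇒meager (F , F-compact , X⊆) = F , compact⇒nowhereDense ∘ F-compact , X⊆

  -- The sum serves as an upper bound for all elements of a finite set.
  capture : ∀ R → Slalom → Target R
  capture ∈* s   = s
  capture ≤* s n = sum (elements (at s n))
  capture ≠* s n = suc (sum (elements (at s n)))

  capture-correct : ∀ R {x s} → x ⟦ ∈* ⟧ s → x ⟦ R ⟧ capture R s
  capture-correct ∈* x∈s     = x∈s
  capture-correct ≤* (m , h) = m , λ n m≤n → ∈⇒≤sum (h n m≤n)
  capture-correct ≠* (m , h) = m , λ n m≤n eq → ℕ.<-irrefl eq (s≤s (∈⇒≤sum (h n m≤n)))

  escape : ∀ R (y : Target R) → Σ[ x ∈ ωω ] ¬ x ⟦ R ⟧ y
  escape ∈* s = (λ n → suc (sum (elements (at s n)))) , λ { (m , h) → ℕ.<-irrefl refl (∈⇒≤sum (h m ℕ.≤-refl)) }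
  escape ≤* y = suc ∘ y , λ { (m , h) → ℕ.<-irrefl refl (h m ℕ.≤-refl) }
  escape ≠* y = y , λ { (m , h) → h m ℕ.≤-refl refl }

  prepend : Bool → (ℕ → Bool) → ℕ → Bool
  prepend c b zero    = c
  prepend c b (suc n) = b n

  -- One of the two halves of 2^ω misses the added point.
  Small-Maybe : ∀ {I} → Small I → Small (Maybe I)
  Small-Maybe {I} small inj = case em
    where
    open Injection inj using (to; injective)
    avoiding : ∀ c → (∀ b → to (prepend c b) ≢ nothing) → ⊥
    avoiding c avoids = small (mk↣ {to = proj₁ ∘ point} λ {b} {b′} eq →
      cong (_∘ suc) (injective {prepend c b} {prepend c b′}
        (trans (proj₂ (point b)) (trans (cong just eq) (sym (proj₂ (point b′)))))))
      where
      point : ∀ b → ∃[ i ] to (prepend c b) ≡ just i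
      point b with to (prepend c b) | avoids b
      ... | just i  | _   = i , refl
      ... | nothing | ≢   = contradiction refl ≢
    case : Dec (∃[ b ] to (prepend true b) ≡ nothing) → ⊥
    case (yes (b , eq)) = avoiding false λ b′ eq′ →
      contradiction (cong (λ f → f 0) (injective {prepend true b} {prepend false b′} (trans eq (sym eq′)))) λ ()
    case (no ∄b)        = avoiding true λ b eq → ∄b (b , eq)

  -- One type for the codes of both null and meager sets; `graph` below injects it into 2^ω.
  Codes : Set
  Codes = List ℕ → List ℕ

  -- Every set in 𝒩 is contained in the null set ⋂ₙ⋃ₖ N(φ(n,k)) and every meager set in ⋃ₙ Fₙ, where
  -- N(s ⌢ φ(n,s)) misses Fₙ for all s, for some φ.
  Base : Ideal → Codes → Pred ωω 0ℓ
  Base 𝒩 φ x = (∀ n → ∃[ k ] x ∈ N (φ (n ∷ k ∷ []))) × (∀ n j → ∑[ j ] (λ k → μN (φ (n ∷ k ∷ []))) ℚ.≤ ½^ n)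
  Base ℳ φ x = ∃[ n ] ∀ s → ¬ x ∈ N (s ++ φ (n ∷ s))
  Base 𝒦 φ x = Base ℳ φ x

  Base-null : ∀ φ → Null (Base 𝒩 φ)
  Base-null φ with em {P = ∀ n j → ∑[ j ] (λ k → μN (φ (n ∷ k ∷ []))) ℚ.≤ ½^ n}
  -- The base set is empty here, so it lies in any null set, such as a singleton.
  ... | no ¬small = Null-⊆ {Y = λ y → (λ _ → 0) ≡ y} (λ x∈ → contradiction (proj₂ x∈) ¬small) (singleton-null (λ _ → 0))
  ... | yes small = λ ε ε>0 → let n , ½^n≤ε = ½^-archimedean ε ε>0 in
    (λ k → φ (n ∷ k ∷ [])) , (λ x∈ → proj₁ x∈ n) , λ j → ℚ.≤-trans (small n j) ½^n≤ε

  -- Otherwise N s lies in the closure of F: a neighbourhood t of x ∈ N s that misses F would yield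
  -- r, the |t| values of x after s, with N (s ++ r) ⊆ N t.
  nowhereDense-avoid : ∀ {F} → NowhereDense F → ∀ s → ∃[ r ] ∀ x → x ∈ F → ¬ x ∈ N (s ++ r)
  nowhereDense-avoid {F} nd s = dne λ ∄r → nd (pad s) (s , pad-⊏ s , λ {x} x∈s t x∈t →
    dne λ disjoint → ∄r (missing x x∈s t x∈t disjoint))
    where
    missing : ∀ x → x ∈ N s → ∀ t → x ∈ N t → ¬ (∃[ y ] y ∈ N t × y ∈ F) → ∃[ r ] ∀ y → y ∈ F → ¬ y ∈ N (s ++ r)
    missing x x∈s t x∈t disjoint = applyUpTo x∘ l , λ y y∈F y∈ → disjoint (y , y∈t y y∈ , y∈F)
      where
      l = length t
      x∘ : ωω
      x∘ n = x (length s + n)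
      glue : ∀ s x → x ∈ N s → ∀ n → applyUpTo x (length s + n) ≡ s ++ applyUpTo (λ k → x (length s + k)) n
      glue []      x _   n = refl
      glue (a ∷ s) x x∈s n = cong₂ _∷_ (sym (x∈s zero)) (glue s (x ∘ suc) (x∈s ∘ suc) n)
      eq : s ++ applyUpTo x∘ l ≡ applyUpTo x (length s + l)
      eq = sym (glue s x x∈s l)
      y∈t : ∀ y → y ∈ N (s ++ applyUpTo x∘ l) → y ∈ N t
      y∈t y y∈ i = trans (x∈t i) (sym (applyUpTo-agree x y (subst (_⊏ y) eq y∈)
        (ℕ.≤-trans (toℕ<n i) (ℕ.m≤n+m l (length s)))))

  Base-cofinal : ∀ J {X} → X ∈ᴵ J → ∃[ φ ] X ⊆ Base J φ
  Base-cofinal 𝒩 {X} (lift null) = φ , λ {x} x∈ → (λ n → proj₁ (proj₂ (cover n)) x∈) , λ n → proj₂ (proj₂ (cover n))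
    where
    cover : ∀ n → Σ[ s ∈ (ℕ → List ℕ) ] X ⊆ ⋃ ℕ (λ k → N (s k)) × (∀ j → ∑[ j ] (λ k → μN (s k)) ℚ.≤ ½^ n)
    cover n = null (½^ n) (½^-pos n)
    φ : Codes
    φ (n ∷ k ∷ []) = proj₁ (cover n) k
    φ _            = []
  Base-cofinal ℳ {X} (F , nd , X⊆) = φ , λ {x} x∈ →
    let n , x∈F = X⊆ x∈ in n , λ s → proj₂ (nowhereDense-avoid (nd n) s) x x∈F
    where
    φ : Codes
    φ []      = []
    φ (n ∷ s) = proj₁ (nowhereDense-avoid (nd n) s)
  -- σ-bounded sets are meager, so the meager base also covers the sets in 𝒦.
  Base-cofinal 𝒦 X∈ = Base-cofinal ℳ (σBounded⇒meager X∈)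

  module Perfect (φ : Codes) where

    digit : Bool → ℕ
    digit false = 0
    digit true  = 1

    digit-injective : ∀ {c d} → digit c ≡ digit d → c ≡ d
    digit-injective {false} {false} _ = refl
    digit-injective {true}  {true}  _ = refl

    -- Stage n appends the bit b(n), which keeps different b apart, and then the string that leaves
    -- the n-th nowhere dense set.
    initial : (ℕ → Bool) → ℕ → List ℕ
    initial b zero    = []
    initial b (suc n) = let s = initial b n ++ [ digit (b n) ] in s ++ φ (n ∷ s)

    added : (ℕ → Bool) → ℕ → List ℕ
    added b n = φ (n ∷ initial b n ++ [ digit (b n) ])

    initial-eq : ∀ b n → initial b (suc n) ≡ initial b n ++ digit (b n) ∷ added b n
    initial-eq b n = ++-assoc (initial b n) [ digit (b n) ] (added b n)

    initial-long : ∀ b n → n ≤ length (initial b n)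
    initial-long b zero    = z≤n
    initial-long b (suc n) = begin
      suc n                                                   ≡⟨ ℕ.+-comm 1 n ⟩
      n + 1                                                   ≤⟨ ℕ.+-mono-≤ (initial-long b n) (s≤s z≤n) ⟩
      length (initial b n) + length (digit (b n) ∷ added b n) ≡⟨ length-++ (initial b n) ⟨
      length (initial b n ++ digit (b n) ∷ added b n)         ≡⟨ cong length (initial-eq b n) ⟨
      length (initial b (suc n))                              ∎
      where open ℕ.≤-Reasoning

    limit-initial : ∀ b → ∃[ x ] ∀ n → initial b n ⊏ x
    limit-initial b = limit (initial b) _ (initial-eq b) (initial-long b)

    point : (ℕ → Bool) → ωω
    point b = proj₁ (limit-initial b)

    point∉Base : ∀ b → ¬ Base ℳ φ (point b)
    point∉Base b (n , avoids) = avoids (initial b n ++ [ digit (b n) ]) (proj₂ (limit-initial b) (suc n))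

    point-digit : ∀ b n → point b (length (initial b n)) ≡ digit (b n)
    point-digit b n = ⊏-∷ʳ (initial b n) {x = point b}
      (subst (_⊏ point b) (initial-eq b n) (proj₂ (limit-initial b) (suc n)))

    -- The place of bit n depends only on the earlier bits, so the bits are recovered one after
    -- another.
    point-injective : ∀ {b c} → point b ≡ point c → b ≡ c
    point-injective {b} {c} eq = ext λ n → bit n (initials n)
      where
      bit : ∀ n → initial b n ≡ initial c n → b n ≡ c n
      bit n eqₙ = digit-injective (trans (sym (point-digit b n))
        (trans (cong₂ (λ x s → x (length s)) eq eqₙ) (point-digit c n)))
      initials : ∀ n → initial b n ≡ initial c n
      initials zero    = refl
      initials (suc n) = cong₂ (λ s d → (s ++ [ digit d ]) ++ φ (n ∷ s ++ [ digit d ])) (initials n) (bit n (initials n))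

  -- The boxes below y + c are compact, and the finitely many exceptions of x are absorbed by taking
  -- c to be the sum of its first m values.
  ≤*-bounded⇒σ-Bounded : ∀ y {X} → (∀ x → x ∈ X → x ⟦ ≤* ⟧ y) → σ-Bounded X
  ≤*-bounded⇒σ-Bounded y X≤y = (λ c x → ∀ n → x n ≤ y n + c) , (λ c → bounded-compact (λ n → y n + c)) ,
    λ {x} x∈ → let m , h = X≤y x x∈ in sum (applyUpTo x m) , excess x m h
    where
    excess : ∀ x m → (∀ n → m ≤ n → x n ≤ y n) → ∀ n → x n ≤ y n + sum (applyUpTo x m)
    excess x m h n with n ℕ.<? m
    ... | yes n<m = ℕ.≤-trans (∈⇒≤sum (∈-applyUpTo⁺ x n<m)) (ℕ.m≤n+m _ (y n))
    ... | no n≮m  = ℕ.≤-trans (h n (ℕ.≮⇒≥ n≮m)) (ℕ.m≤m+n (y n) _)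

  module Ideals (add𝒩≡𝔠 : add𝒩-is 𝔠) where

    open AdditivityOfNull add𝒩≡𝔠

    localiseᴿ : ∀ R {I : Set} → Small I → (F : I → ωω) → Σ[ y ∈ Target R ] ∀ i → F i ⟦ R ⟧ y
    localiseᴿ R small F = let s , h = localise small F in capture R s , λ i → capture-correct R (h i)

    small-σBounded : ∀ {I : Set} → Small I → (F : I → ωω) →
                     ∀ {X} → (∀ x → x ∈ X → ∃[ i ] F i ≡ x) → σ-Bounded X
    small-σBounded small F X⊆ = let y , F≤y = localiseᴿ ≤* small F in
      ≤*-bounded⇒σ-Bounded y λ x x∈ → let i , eq = X⊆ x x∈ in subst (_⟦ ≤* ⟧ y) eq (F≤y i)

    small-∈ᴵ : ∀ J {I : Set} → Small I → (F : I → ωω) → ∀ {X} → (∀ x → x ∈ X → ∃[ i ] F i ≡ x) → X ∈ᴵ J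
    small-∈ᴵ 𝒩 small F X⊆ = lift (Null-⊆ (X⊆ _) (⋃-null small (λ i y → F i ≡ y) (singleton-null ∘ F)))
    small-∈ᴵ ℳ small F X⊆ = σBounded⇒meager (small-σBounded small F X⊆)
    small-∈ᴵ 𝒦 small F X⊆ = small-σBounded small F X⊆

    -- For 𝒩, the base set and the points F i form a small family of null sets, which cannot cover
    -- the space. For ℳ, there are 2^ω many points off the base set, too many to be listed by F.
    Base-escape : ∀ J φ {I : Set} → Small I → (F : I → ωω) → ∃[ x ] ¬ Base J φ x × ∀ i → F i ≢ x
    Base-escape 𝒩 φ {I} small F = dne λ ∄x → U-not-null (Null-⊆ (λ {x} _ → dne λ ∉parts →
      ∄x (x , (λ x∈ → ∉parts (nothing , x∈)) , λ i eq → ∉parts (just i , eq)))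
      (⋃-null (Small-Maybe small) part part-null))
      where
      part : Maybe I → Pred ωω 0ℓ
      part nothing  = Base 𝒩 φ
      part (just i) = λ y → F i ≡ y
      part-null : ∀ i → Null (part i)
      part-null nothing  = Base-null φ
      part-null (just i) = singleton-null (F i)
    Base-escape ℳ φ {I} small F = dne λ ∄x →
      let hit : ∀ b → ∃[ i ] F i ≡ point b
          hit b = dne λ ∄i → ∄x (point b , point∉Base b , λ i eq → ∄i (i , eq))
      in small (mk↣ {to = proj₁ ∘ hit} λ {b} {c} eq →
           point-injective (trans (sym (proj₂ (hit b))) (trans (cong F eq) (proj₂ (hit c)))))
      where open Perfect φ
    Base-escape 𝒦 φ small F = Base-escape ℳ φ small F

  -- Well-orderings of 2^ω

  -- Truth values as Booleans make subsets of X elements of a `Set`, equal once they have the same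
  -- members, and make proofs of membership unique.
  ⌊_⌋ : Set → Bool
  ⌊ P ⌋ = does (em {P = P})

  ⌊⌋-true : ∀ {P} → P → ⌊ P ⌋ ≡ true
  ⌊⌋-true {P} p with em {P = P}
  ... | yes _ = refl
  ... | no ¬p = contradiction p ¬p

  true-⌊⌋ : ∀ {P} → ⌊ P ⌋ ≡ true → P
  true-⌊⌋ {P} eq with em {P = P}
  ... | yes p = p
  true-⌊⌋ {P} () | no _

  record WellOrder (X : Set) : Set where
    field
      lt          : X → X → Bool
      wellFounded : WellFounded (λ x y → lt x y ≡ true)
      connex      : ∀ x y → x ≡ y ⊎ lt x y ≡ true ⊎ lt y x ≡ true

    Segment : X → Set
    Segment x = ∃[ y ] lt y x ≡ true

  -- The sets obtained from ∅ by adding chosen new points and taking unions form a chain.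
  module Zermelo (X : Set) (x₀ : X) where

    Subset : Set
    Subset = X → Bool

    infix 4 _∋_ _⊑_

    _∋_ : Subset → X → Set
    S ∋ x = S x ≡ true

    _⊑_ : Subset → Subset → Set
    S ⊑ T = ∀ x → S ∋ x → T ∋ x

    ⊑-antisym : ∀ {S T} → S ⊑ T → T ⊑ S → S ≡ T
    ⊑-antisym {S} {T} S⊑T T⊑S = ext λ x → same (S x) (T x) (S⊑T x) (T⊑S x)
      where
      same : ∀ b c → (b ≡ true → c ≡ true) → (c ≡ true → b ≡ true) → b ≡ c
      same true  c     f g = sym (f refl)
      same false true  f g = g refl
      same false false f g = refl

    new : Subset → X
    new S with em {P = ∃[ x ] ¬ S ∋ x}
    ... | yes (x , _) = x
    ... | no _        = x₀

    new-∌ : ∀ S {x} → ¬ S ∋ x → ¬ S ∋ new S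
    new-∌ S {x} S∌x with em {P = ∃[ x ] ¬ S ∋ x}
    ... | yes (_ , ∌) = ∌
    ... | no ∄x       = contradiction (x , S∌x) ∄x

    next : Subset → Subset
    next S x = ⌊ (S ∋ x ⊎ x ≡ new S) ⌋

    ⊑-next : ∀ S → S ⊑ next S
    ⊑-next S x ∋x = ⌊⌋-true (inj₁ ∋x)

    union : (Subset → Bool) → Subset
    union 𝓢 x = ⌊ (∃[ S ] 𝓢 S ≡ true × S ∋ x) ⌋

    ⊑-union : ∀ {𝓢 S} → 𝓢 S ≡ true → S ⊑ union 𝓢
    ⊑-union S∈ x ∋x = ⌊⌋-true (_ , S∈ , ∋x)

    union-⊑ : ∀ {𝓢 T} → (∀ S → 𝓢 S ≡ true → S ⊑ T) → union 𝓢 ⊑ T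
    union-⊑ h x ∋x = let S , S∈ , S∋x = true-⌊⌋ ∋x in h S S∈ x S∋x

    data Tower : Subset → Set where
      nextᵀ  : ∀ {S} → Tower S → Tower (next S)
      unionᵀ : ∀ {𝓢} → (∀ S → 𝓢 S ≡ true → Tower S) → Tower (union 𝓢)

    -- Inner induction, on T: no member of the tower lies strictly between S and its successor.
    next-dichotomy : ∀ {S} → (∀ {T} → Tower T → S ⊑ T ⊎ next T ⊑ S) →
                     ∀ {T} → Tower T → T ⊑ S ⊎ next S ⊑ T
    next-dichotomy {S} h (nextᵀ {T} τ) with next-dichotomy h τ | h τ
    ... | inj₂ sS⊑T | _         = inj₂ (λ x → ⊑-next T x ∘ sS⊑T x)
    ... | inj₁ _    | inj₂ sT⊑S = inj₁ sT⊑S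
    ... | inj₁ T⊑S  | inj₁ S⊑T  = inj₂ (subst (λ V → next S ⊑ next V) (⊑-antisym S⊑T T⊑S) (λ _ ∋x → ∋x))
    next-dichotomy {S} h (unionᵀ {𝓢} τs) with em {P = ∃[ T ] 𝓢 T ≡ true × next S ⊑ T}
    ... | yes (T , T∈ , sS⊑T) = inj₂ (λ x → ⊑-union T∈ x ∘ sS⊑T x)
    ... | no ∄T = inj₁ (union-⊑ λ T T∈ → case T∈ (next-dichotomy h (τs T T∈)))
      where
      case : ∀ {T} → 𝓢 T ≡ true → T ⊑ S ⊎ next S ⊑ T → T ⊑ S
      case T∈ (inj₁ T⊑S)  = T⊑S
      case T∈ (inj₂ sS⊑T) = contradiction (_ , T∈ , sS⊑T) ∄T

    -- Outer induction, on S, feeding its hypothesis to the inner one.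
    dichotomy : ∀ {S T} → Tower S → Tower T → S ⊑ T ⊎ next T ⊑ S
    dichotomy {T = T} (nextᵀ {S} σ) τ with next-dichotomy (dichotomy σ) τ | dichotomy σ τ
    ... | inj₂ sS⊑T | _         = inj₁ sS⊑T
    ... | inj₁ _    | inj₂ sT⊑S = inj₂ (λ x → ⊑-next S x ∘ sT⊑S x)
    ... | inj₁ T⊑S  | inj₁ S⊑T  = inj₂ (subst (λ V → next T ⊑ next V) (⊑-antisym T⊑S S⊑T) (λ _ ∋x → ∋x))
    dichotomy {T = T} (unionᵀ {𝓢} σs) τ with em {P = ∃[ S ] 𝓢 S ≡ true × next T ⊑ S}
    ... | yes (S , S∈ , sT⊑S) = inj₂ (λ x → ⊑-union S∈ x ∘ sT⊑S x)
    ... | no ∄S = inj₁ (union-⊑ λ S S∈ → case S∈ (dichotomy (σs S S∈) τ))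
      where
      case : ∀ {S} → 𝓢 S ≡ true → S ⊑ T ⊎ next T ⊑ S → S ⊑ T
      case S∈ (inj₁ S⊑T)  = S⊑T
      case S∈ (inj₂ sT⊑S) = contradiction (_ , S∈ , sT⊑S) ∄S

    -- Says that x enters the tower before y; this becomes the well-order.
    Separated : X → X → Set
    Separated x y = ∃[ S ] Tower S × S ∋ x × ¬ S ∋ y

    Separated-asym : ∀ {x y} → Separated x y → ¬ Separated y x
    Separated-asym (S , σ , S∋x , S∌y) (T , τ , T∋y , T∌x) with dichotomy σ τ
    ... | inj₁ S⊑T  = T∌x (S⊑T _ S∋x)
    ... | inj₂ sT⊑S = S∌y (sT⊑S _ (⊑-next T _ T∋y))

    -- Take the largest member of the tower disjoint from P. Its successor adds a single point m,
    -- which must lie in P, as otherwise the successor would be disjoint from P too.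
    least : ∀ (P : X → Set) {x} → P x → ∃[ m ] P m × ∀ y → P y → y ≢ m → Separated m y
    least P {x} Px = m , P-m , λ y Py y≢m →
      next avoiding , nextᵀ avoidingᵀ , ⌊⌋-true (inj₂ refl) , ∌-next y Py y≢m
      where
      Avoiding : Subset → Set
      Avoiding S = Tower S × ∀ y → P y → ¬ S ∋ y
      avoiding : Subset
      avoiding = union (λ S → ⌊ Avoiding S ⌋)
      avoidingᵀ : Tower avoiding
      avoidingᵀ = unionᵀ (λ S → proj₁ ∘ true-⌊⌋)
      avoids : ∀ y → P y → ¬ avoiding ∋ y
      avoids y Py ∋y = let S , S∈ , S∋y = true-⌊⌋ ∋y in proj₂ (true-⌊⌋ S∈) y Py S∋y
      m : X
      m = new avoiding
      ∌-next : ∀ y → P y → y ≢ m → ¬ next avoiding ∋ y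
      ∌-next y Py y≢m ∋y with true-⌊⌋ ∋y
      ... | inj₁ ∋y′ = avoids y Py ∋y′
      ... | inj₂ y≡m = y≢m y≡m
      P-m : P m
      P-m = dne λ ¬Pm → new-∌ avoiding (avoids x Px)
        (⊑-union {S = next avoiding} (⌊⌋-true (nextᵀ avoidingᵀ , λ y Py → ∌-next y Py λ { refl → ¬Pm Py }))
                 m (⌊⌋-true (inj₂ refl)))

    wellOrder : WellOrder X
    wellOrder = record
      { lt          = λ x y → ⌊ Separated x y ⌋
      ; wellFounded = wf
      ; connex      = con
      }
      where
      _⊲_ : X → X → Set
      x ⊲ y = ⌊ Separated x y ⌋ ≡ true
      wf : WellFounded _⊲_
      wf x = dne λ ¬acc → let m , ¬acc-m , m-least = least (λ y → ¬ Acc _⊲_ y) ¬acc in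
        ¬acc-m (acc λ {y} y<m → dne λ ¬acc-y →
          Separated-asym (true-⌊⌋ y<m) (m-least y ¬acc-y λ { refl → Separated-asym (true-⌊⌋ y<m) (true-⌊⌋ y<m) }))
      con : ∀ x y → x ≡ y ⊎ x ⊲ y ⊎ y ⊲ x
      con x y with em {P = x ≡ y}
      ... | yes x≡y = inj₁ x≡y
      ... | no x≢y with least (λ z → z ≡ x ⊎ z ≡ y) (inj₁ refl)
      ... | _ , inj₁ refl , h = inj₂ (inj₁ (⌊⌋-true (h y (inj₂ refl) (x≢y ∘ sym))))
      ... | _ , inj₂ refl , h = inj₂ (inj₂ (⌊⌋-true (h x (inj₁ refl) x≢y)))

  segment-≡ : ∀ {X : Set} {f : X → Bool} {i j : ∃[ x ] f x ≡ true} → proj₁ i ≡ proj₁ j → i ≡ j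
  segment-≡ {i = x , refl′} {j = .x , p} refl = cong (x ,_) (uip refl′ p)
    where
    uip : ∀ {b : Bool} (p q : b ≡ true) → p ≡ q
    uip refl refl = refl

  pullback : ∀ {X Y : Set} (f : X → Y) → (∀ {x y} → f x ≡ f y → x ≡ y) → WellOrder Y → WellOrder X
  pullback f f-inj W = record
    { lt          = λ x y → lt (f x) (f y)
    ; wellFounded = On.wellFounded f wellFounded
    ; connex      = λ x y → case (connex (f x) (f y))
    }
    where
    open WellOrder W
    case : ∀ {x y} {Z : Set} → f x ≡ f y ⊎ Z → x ≡ y ⊎ Z
    case (inj₁ eq) = inj₁ (f-inj eq)
    case (inj₂ z)  = inj₂ z

  -- If some segment has size 𝔠, the least such segment transports its order to 2^ω.
  smallWellOrder : Σ[ W ∈ WellOrder (ℕ → Bool) ] ∀ c → Small (WellOrder.Segment W c)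
  smallWellOrder = case em
    where
    W : WellOrder (ℕ → Bool)
    W = Zermelo.wellOrder (ℕ → Bool) (λ _ → true)
    open WellOrder W
    case : Dec (∃[ c ] ¬ Small (Segment c)) → Σ[ W ∈ WellOrder (ℕ → Bool) ] ∀ c → Small (WellOrder.Segment W c)
    case (no ∄c) = W , λ c → dne λ large → ∄c (c , large)
    case (yes (_ , large)) with minimal wellFounded (λ c → ¬ Small (Segment c)) large
    ... | m , m-large , below-small = pullback j j-injective W , λ c large →
      below-small (j c) (proj₂ (to c)) λ small → Small-↣ (into c) (into-injective c) small large
      where
      open Injection (dne m-large) using (to; injective)
      j : (ℕ → Bool) → (ℕ → Bool)
      j = proj₁ ∘ to
      j-injective : ∀ {b c} → j b ≡ j c → b ≡ c
      j-injective = injective ∘ segment-≡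
      into : ∀ c → ∃[ b ] lt (j b) (j c) ≡ true → Segment (j c)
      into c (b , b<c) = j b , b<c
      into-injective : ∀ c {i i′} → into c i ≡ into c i′ → i ≡ i′
      into-injective c = segment-≡ ∘ j-injective ∘ cong proj₁

  -- Transfinite recursion

  module Recursion {X : Set} (W : WellOrder X) where

    open WellOrder W

    -- At each x a value different from all earlier ones is chosen; connexity then makes the choices
    -- injective.
    recursiveChoice : ∀ {Y : Set} (Q : X → Y → Set) →
      (∀ x (F : Segment x → Y) → ∃[ y ] Q x y × ∀ i → F i ≢ y) →
      ∃[ h ] (∀ x → Q x (h x)) × (∀ {x x′} → h x ≡ h x′ → x ≡ x′)
    recursiveChoice {Y} Q choose = h , (λ x → Q-value x (wellFounded x)) , λ {x} {x′} → h-injective x x′ (connex x x′)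
      where
      value : ∀ x → Acc (λ x y → lt x y ≡ true) x → Y
      earlier : ∀ x → Acc (λ x y → lt x y ≡ true) x → Segment x → Y
      value x a = proj₁ (choose x (earlier x a))
      earlier x (acc rs) (y , y<x) = value y (rs y<x)

      Q-value : ∀ x a → Q x (value x a)
      Q-value x a = proj₁ (proj₂ (choose x (earlier x a)))

      -- The values at y < x are computed inside the recursion from another accessibility proof than
      -- the one in h y.
      value-irrelevant : ∀ x a a′ → value x a ≡ value x a′
      value-irrelevant x (acc rs) (acc rs′) =
        cong (proj₁ ∘ choose x) (ext λ (y , y<x) → value-irrelevant y (rs y<x) (rs′ y<x))

      h : X → Y
      h x = value x (wellFounded x)

      value-new : ∀ x a {y} → lt y x ≡ true → h y ≢ value x a
      value-new x (acc rs) {y} y<x eq = proj₂ (proj₂ (choose x (earlier x (acc rs)))) (y , y<x)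
        (trans (value-irrelevant y (rs y<x) (wellFounded y)) eq)

      h-injective : ∀ x x′ → x ≡ x′ ⊎ lt x x′ ≡ true ⊎ lt x′ x ≡ true → h x ≡ h x′ → x ≡ x′
      h-injective x x′ (inj₁ x≡x′)        _  = x≡x′
      h-injective x x′ (inj₂ (inj₁ x<x′)) eq = contradiction eq (value-new x′ (wellFounded x′) x<x′)
      h-injective x x′ (inj₂ (inj₂ x′<x)) eq = contradiction (sym eq) (value-new x (wellFounded x) x′<x)

  -- The cardinal characteristics

  retract : ∀ {X Y : Set} → (X → Y) → X → Y → X
  retract f x₀ y with em {P = ∃[ x ] f x ≡ y}
  ... | yes (x , _) = x
  ... | no _        = x₀

  retract-inverse : ∀ {X Y : Set} {f : X → Y} → (∀ {x x′} → f x ≡ f x′ → x ≡ x′) → ∀ x₀ x → retract f x₀ (f x) ≡ x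
  retract-inverse {f = f} f-inj x₀ x with em {P = ∃[ x′ ] f x′ ≡ f x}
  ... | yes (_ , eq) = f-inj eq
  ... | no ∄x′       = contradiction (x , refl) ∄x′

  -- Coding by elements of 2^ω

  abstract
    graph : Codes → ℕ → Bool
    graph φ m = ⌊ (∃[ s ] pairEnc s (φ s) ≡ m) ⌋

    graph-injective : ∀ {φ ψ} → graph φ ≡ graph ψ → φ ≡ ψ
    graph-injective {φ} {ψ} eq = ext same
      where
      same : ∀ s → φ s ≡ ψ s
      same s with true-⌊⌋ (trans (cong (λ g → g (pairEnc s (φ s))) (sym eq)) (⌊⌋-true (s , refl)))
      ... | t , eqₜ with pairEnc-injective {t} {ψ t} {s} {φ s} eqₜ
      ... | refl , ψs≡φs = sym ψs≡φs

  -- The well-order of 2^ω is carried over to reals by this index; `map x` determines x through its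
  -- values on one-element lists.
  index : ωω → ℕ → Bool
  index x = graph (map x)

  index-injective : ∀ {x y} → index x ≡ index y → x ≡ y
  index-injective {x} {y} eq = ext λ n → ∷-injectiveˡ (cong (λ φ → φ (n ∷ [])) (graph-injective {map x} {map y} eq))

  -- Lists with head 0 store b, addressed by the length of the tail; all others store φ with the
  -- head shifted.
  tagged : (ℕ → Bool) × Codes → Codes
  tagged (b , φ) []          = φ []
  tagged (b , φ) (zero ∷ s)  = if b (length s) then [] else 0 ∷ []
  tagged (b , φ) (suc k ∷ s) = φ (k ∷ s)

  tagged-injective : ∀ {p q} → tagged p ≡ tagged q → p ≡ q
  tagged-injective {b , φ} {c , ψ} eq = cong₂ _,_ (ext bit) (ext same)
    where
    if-injective : ∀ {x y} → (if x then [] else 0 ∷ []) ≡ (if y then [] else 0 ∷ []) → x ≡ y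
    if-injective {true}  {true}  _ = refl
    if-injective {false} {false} _ = refl
    if-injective {true}  {false} ()
    if-injective {false} {true}  ()
    bit : ∀ n → b n ≡ c n
    bit n = subst (λ l → b l ≡ c l) (length-replicate n) (if-injective (cong (λ χ → χ (0 ∷ replicate n 0)) eq))
    same : ∀ s → φ s ≡ ψ s
    same []      = cong (λ χ → χ []) eq
    same (k ∷ s) = cong (λ χ → χ (suc k ∷ s)) eq

  unpairing : Σ[ u ∈ ((ℕ → Bool) → (ℕ → Bool) × Codes) ] ∀ p → ∃[ c ] u c ≡ p
  unpairing = retract (graph ∘ tagged) default , λ p →
    graph (tagged p) , retract-inverse {f = graph ∘ tagged} (λ eq → tagged-injective (graph-injective eq)) default p
    where
    default : (ℕ → Bool) × Codes
    default = (λ _ → true) , λ s → s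

  Small-⊥ : Small ⊥
  Small-⊥ inj = Injection.to inj (λ _ → true)

  -- Comparison with 𝔠

  module _ (W : WellOrder (ℕ → Bool)) where

    open WellOrder W
    open Recursion W

    -- New elements of A can be chosen along W: if some segment exhausted A, sending elements to
    -- their positions in it would inject A into 2^ω.
    ⋠⇒≺ : ∀ {Y : Set} (A : Pred Y 0ℓ) → ¬ (size (setoid Y) A ≼ 𝔠) → 𝔠 ≺ size (setoid Y) A
    ⋠⇒≺ {Y} A ⋠ = record { to = λ b → h b , h∈A b ; cong = cong h ; injective = h-injective } , ⋠
      where
      position : ∀ {b} → (Segment b → Y) → Y → ℕ → Bool
      position F y with em {P = ∃[ i ] F i ≡ y}
      ... | yes ((c , _) , _) = c
      ... | no _              = λ _ → true

      position-injective : ∀ {b} (F : Segment b → Y) {y z} → ∃[ i ] F i ≡ y → ∃[ i ] F i ≡ z →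
                           position F y ≡ position F z → y ≡ z
      position-injective F {y} {z} y∈ z∈ eq with em {P = ∃[ i ] F i ≡ y} | em {P = ∃[ i ] F i ≡ z}
      ... | yes (i , Fi≡y) | yes (j , Fj≡z) = trans (sym Fi≡y) (trans (cong F (segment-≡ eq)) Fj≡z)
      ... | no ∄i          | _              = contradiction y∈ ∄i
      ... | yes _          | no ∄j          = contradiction z∈ ∄j

      choose : ∀ b (F : Segment b → Y) → ∃[ y ] y ∈ A × ∀ i → F i ≢ y
      choose b F = dne λ ∄y →
        let hit : ∀ y → y ∈ A → ∃[ i ] F i ≡ y
            hit y y∈A = dne λ ∄i → ∄y (y , y∈A , λ i eq → ∄i (i , eq))
        in ⋠ (record { to = position F ∘ proj₁ ; cong = cong (position F)
                     ; injective = λ { {y , y∈A} {z , z∈A} → position-injective F (hit y y∈A) (hit z z∈A) } })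

      recursion : ∃[ h ] (∀ b → h b ∈ A) × (∀ {b c} → h b ≡ h c → b ≡ c)
      recursion = recursiveChoice (λ _ → A) choose
      h = proj₁ recursion
      h∈A = proj₁ (proj₂ recursion)
      h-injective = proj₂ (proj₂ recursion)

  enumerate : ∀ {Y : Set} {A : Pred Y 0ℓ} (ι : size (setoid Y) A ≼ 𝔠) → Y →
              ∃[ f ] ∀ a → f (Injection.to ι a) ≡ proj₁ a
  enumerate {Y} {A} ι y₀ = f , f-to
    where
    open Injection ι using (to; injective)
    f : (ℕ → Bool) → Y
    f c with em {P = ∃[ a ] to a ≡ c}
    ... | yes (a , _) = proj₁ a
    ... | no _        = y₀
    f-to : ∀ a → f (to a) ≡ proj₁ a
    f-to a with em {P = ∃[ a′ ] to a′ ≡ to a}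
    ... | yes (_ , eq) = injective eq
    ... | no ∄a        = contradiction (a , refl) ∄a

  -- Bounds for 𝔟 and 𝔡

  module Main (add𝒩≡𝔠 : add𝒩-is 𝔠) (W : WellOrder (ℕ → Bool))
              (small : ∀ c → Small (WellOrder.Segment W c)) where

    open Ideals add𝒩≡𝔠
    open WellOrder W
    open Recursion W

    -- Distinct points x_c ∉ Base J φ, labelled b, are chosen for all c coding a pair (b, φ).
    positivePartition : ∀ J → Σ[ label ∈ (ωω → ℕ → Bool) ] ∀ b {X} → X ∈ᴵ J → ∃[ x ] label x ≡ b × ¬ x ∈ X
    positivePartition J = fromPoints unpairing
      where
      Unpairing = Σ[ u ∈ ((ℕ → Bool) → (ℕ → Bool) × Codes) ] ∀ p → ∃[ c ] u c ≡ p
      fromPoints : Unpairing → Σ[ label ∈ (ωω → ℕ → Bool) ] ∀ b {X} → X ∈ᴵ J → ∃[ x ] label x ≡ b × ¬ x ∈ X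
      fromPoints (u , u-onto) = fromRecursion (recursiveChoice (λ c x → ¬ Base J (proj₂ (u c)) x)
                                                 (λ c → Base-escape J (proj₂ (u c)) (small c)))
        where
        fromRecursion : ∃[ h ] (∀ c → ¬ Base J (proj₂ (u c)) (h c)) × (∀ {c d} → h c ≡ h d → c ≡ d) →
                        Σ[ label ∈ (ωω → ℕ → Bool) ] ∀ b {X} → X ∈ᴵ J → ∃[ x ] label x ≡ b × ¬ x ∈ X
        -- Points outside the range of h all receive the label coded by the constant sequence
        -- `true`; enlarging one class does no harm.
        fromRecursion (h , h∉ , h-injective) = (λ x → proj₁ (u (retract h (λ _ → true) x))) , positive
          where
          positive : ∀ b {X} → X ∈ᴵ J → ∃[ x ] proj₁ (u (retract h (λ _ → true) x)) ≡ b × ¬ x ∈ X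
          positive b X∈ with Base-cofinal J X∈
          ... | φ , X⊆ with u-onto (b , φ)
          ... | c , eq = h c ,
            trans (cong (proj₁ ∘ u) (retract-inverse h-injective (λ _ → true) c)) (cong proj₁ eq) ,
            λ x∈ → subst (λ p → ¬ Base J (proj₂ p) (h c)) eq (h∉ c) (X⊆ x∈)

    module _ (J : Ideal) (R : Rel) where

      ω^ω∉ᴵ : ∀ {X} → X ∈ᴵ J → ¬ (∀ x → x ∈ X)
      ω^ω∉ᴵ X∈ all = let φ , X⊆ = Base-cofinal J X∈
                         x , x∉ , _ = Base-escape J φ Small-⊥ λ ()
                     in x∉ (X⊆ (all x))

      -- Shows that the minimum defining 𝔟 is over a nonempty class: the function escaping g at
      -- every x would fail only on a set in J.
      all-unbounded : Unbounded R J (λ _ → ⊤)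
      all-unbounded (g , bounds) = ω^ω∉ᴵ (bounds (λ x → proj₁ (escape R (g x))) tt) (λ x → proj₂ (escape R (g x)))

      all-dominating : Dominating R J (λ _ → ⊤)
      all-dominating g = (λ x → proj₁ (above x)) , tt , 
        small-∈ᴵ J Small-⊥ (λ ()) (λ x ∉R → contradiction (proj₂ (above x) nothing) ∉R)
        where
        above : ∀ x → Σ[ y ∈ Target R ] ∀ (i : Maybe ⊥) → g x ⟦ R ⟧ y
        -- `Maybe ⊥` is a one-point index set, so this yields a y with g x R y at every x, and the
        -- exceptional set is empty.
        above x = localiseᴿ R (Small-Maybe Small-⊥) (λ _ → g x)

      small⇒bounded : ∀ {A} → size (setoid (ωω → ωω)) A ≼ 𝔠 → Σ[ g ∈ (ωω → Target R) ] ∀ f → f ∈ A → _⟦_,_⟧_ f R J g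
      -- Exceptional x have index at most that of f: they are listed by the segment below it,
      -- together with `nothing` for equality.
      small⇒bounded {A} ι = g , λ f f∈A → small-∈ᴵ J (Small-Maybe (small (to (f , f∈A)))) (points (to (f , f∈A)))
        λ x ∉R → exceptional f f∈A x ∉R (connex (index x) (to (f , f∈A)))
        where
        open Injection ι using (to)
        F : (ℕ → Bool) → ωω → ωω
        F = proj₁ (enumerate ι (λ x → x))
        above : ∀ x → Σ[ y ∈ Target R ] ∀ (i : Segment (index x)) → F (proj₁ i) x ⟦ R ⟧ y
        above x = localiseᴿ R (small (index x)) (λ i → F (proj₁ i) x)
        g : ωω → Target R
        g = proj₁ ∘ above
        point : (ℕ → Bool) → ωω
        point = retract index (λ _ → 0)
        point-index : ∀ x → point (index x) ≡ x
        point-index = retract-inverse {f = index} index-injective (λ _ → 0)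
        points : ∀ c → Maybe (Segment c) → ωω
        points c nothing        = point c
        points c (just (b , _)) = point b
        exceptional : ∀ f (f∈A : f ∈ A) x → ¬ f x ⟦ R ⟧ g x →
                      index x ≡ to (f , f∈A) ⊎ lt (index x) (to (f , f∈A)) ≡ true ⊎
                      lt (to (f , f∈A)) (index x) ≡ true →
                      ∃[ i ] points (to (f , f∈A)) i ≡ x
        exceptional f f∈A x ∉R (inj₁ eq)        = nothing , trans (cong point (sym eq)) (point-index x)
        exceptional f f∈A x ∉R (inj₂ (inj₁ x<)) = just (index x , x<) , point-index x
        exceptional f f∈A x ∉R (inj₂ (inj₂ <x)) = contradiction
          (subst (λ f → f x ⟦ R ⟧ g x) (proj₂ (enumerate ι (λ x → x)) (f , f∈A)) (proj₂ (above x) (to (f , f∈A) , <x))) ∉R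

      small⇒¬dominating : ∀ {A} → size (setoid (ωω → Target R)) A ≼ 𝔠 → ¬ Dominating R J A
      small⇒¬dominating {A} ι dominating =
        contra (enumerate ι (λ _ → proj₁ (localiseᴿ R Small-⊥ λ ()))) (positivePartition J)
        where
        open Injection ι using (to)
        contra : ∃[ F ] (∀ a → F (to a) ≡ proj₁ a) →
                 ¬ (Σ[ label ∈ (ωω → ℕ → Bool) ] ∀ b {X} → X ∈ᴵ J → ∃[ x ] label x ≡ b × ¬ x ∈ X)
        -- The diagonal function escapes, at x, the family member numbered by the label of x. If f
        -- dominated it, the class labelled by the number of f would still contain a point outside
        -- the exceptional set.
        contra (F , F-to) (label , positive) with dominating (λ x → proj₁ (escape R (F (label x) x)))
        ... | f , f∈A , g≤f with positive (to (f , f∈A)) g≤f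
        ... | x , eq , x∉ = x∉ (subst (λ f → ¬ proj₁ (escape R (F (label x) x)) ⟦ R ⟧ f x)
                                 (trans (cong F eq) (F-to (f , f∈A))) (proj₂ (escape R (F (label x) x))))

      𝔠⁺≤𝔟 : 𝔠 ⁺≤𝔟⟦ R , J ⟧
      𝔠⁺≤𝔟 = ((λ _ → ⊤) , all-unbounded) , λ A unbounded → ⋠⇒≺ W A λ ι → unbounded (small⇒bounded ι)

      𝔠⁺≤𝔡 : 𝔠 ⁺≤𝔡⟦ R , J ⟧
      𝔠⁺≤𝔡 = ((λ _ → ⊤) , all-dominating) , λ A dominating → ⋠⇒≺ W A λ ι → small⇒¬dominating ι dominating

theorem1p2 : (∀ {ℓ} → ExcludedMiddle ℓ) →
    (∀ {a b} → Extensionality a b) →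
    add𝒩-is 𝔠 →
    ∀ (I : Ideal) (R : Rel) → 𝔠 ⁺≤𝔟⟦ R , I ⟧ × 𝔠 ⁺≤𝔡⟦ R , I ⟧
theorem1p2 em ext add𝒩≡𝔠 I R = 𝔠⁺≤𝔟 I R , 𝔠⁺≤𝔡 I R
  where
  open Classical em ext
  open Main add𝒩≡𝔠 (proj₁ smallWellOrder) (proj₂ smallWellOrder)
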